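{- For a nonnegative integer $n$, let $b_3(n)$ denote the number of $3$-regular partitions of $n$. Let $\alpha\in\{6,64,93,122,151,180,209,238,267,296,325,354,383,412,441,470,499,528,557,586,615,644,673,702,731,760,789,818\}$. Then for all integers $n\geq 0$, $$b_3(2(29^2\cdot n+\alpha))\equiv 0\pmod 2.$$
   Context: For a positive integer $\ell$, an $\ell$-regular partition of $n$ is a partition of $n$ none of whose parts is divisible by $\ell$; $b_\ell(n)$ denotes the number of $\ell$-regular partitions of $n$, with $b_\ell(0)=1$. Equivalently, $\sum_{n=0}^{\infty}b_{\ell}(n)q^n=\prod_{j=1}^{\infty}\frac{1-q^{\ell j}}{1-q^{j}}$. -}

module Defs where

open import Data.List.Base using (List; []; _∷_; length; filter; upTo; cartesianProductWith)
open import Data.List.Membership.Propositional using (_∈_)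
open import Data.List.Membership.Propositional.Properties
  using (∈-cartesianProductWith⁺; ∈-cartesianProductWith⁻; ∈-upTo⁺; ∈-filter⁺; ∈-filter⁻)
open import Data.List.Properties using (∷-injective)
open import Data.List.Relation.Unary.All as All using (All; []; _∷_)
open import Data.List.Relation.Unary.AllPairs using ([]; _∷_)
open import Data.List.Relation.Unary.Any using (here; there)
open import Data.List.Relation.Unary.Linked using (Linked; linked?)
open import Data.List.Relation.Unary.Unique.Propositional using (Unique)
import Data.List.Relation.Unary.Unique.Propositional.Properties as Unique
open import Data.Nat.Base
open import Data.Nat.Divisibility using (_∤_; _∣?_)
open import Data.Nat.ListAction using (sum)
open import Data.Nat.Properties
open import Data.Product.Base using (_×_; _,_; proj₂)
open import Function.Bundles using (_⇔_; mk⇔)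
open import Relation.Binary.PropositionalEquality using (_≡_; _≢_; refl)
open import Relation.Nullary.Decidable using (Dec; ¬?; map′; _×-dec_)

record IsPartition (n : ℕ) (ps : List ℕ) : Set where
  constructor mkIsPartition
  field
    positive      : All (_> 0) ps
    nonincreasing : Linked _≥_ ps
    total         : sum ps ≡ n

open IsPartition public

record IsRegularPartition (ℓ n : ℕ) (ps : List ℕ) : Set where
  constructor mkIsRegularPartition
  field
    isPartition : IsPartition n ps
    regular     : All (ℓ ∤_) ps

open IsRegularPartition public

isPartition? : ∀ n ps → Dec (IsPartition n ps)
isPartition? n ps =
  map′ (λ (p , d , t) → mkIsPartition p d t)
       (λ p → positive p , nonincreasing p , total p)
       (All.all? (_>? 0) ps ×-dec linked? _≥?_ ps ×-dec (sum ps ≟ n))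

isRegularPartition? : ∀ ℓ n ps → Dec (IsRegularPartition ℓ n ps)
isRegularPartition? ℓ n ps =
  map′ (λ (p , r) → mkIsRegularPartition p r)
       (λ p → isPartition p , regular p)
       (isPartition? n ps ×-dec All.all? (λ p → ¬? (ℓ ∣? p)) ps)

-- All lists of length at most k with entries at most m.
words : (k m : ℕ) → List (List ℕ)
words zero    m = [] ∷ []
words (suc k) m = [] ∷ cartesianProductWith _∷_ (upTo (suc m)) (words k m)

-- A partition of n has at most n parts, each at most n, so `words n n`
-- contains all of them; see ∈-regularPartitions and regularPartitions-unique.
regularPartitions : (ℓ n : ℕ) → List (List ℕ)
regularPartitions ℓ n = filter (isRegularPartition? ℓ n) (words n n)

b : (ℓ n : ℕ) → ℕ
b ℓ n = length (regularPartitions ℓ n)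

∈-words : ∀ {k m ps} → length ps ≤ k → All (_≤ m) ps → ps ∈ words k m
∈-words {zero}  {ps = []}     _       _          = here refl
∈-words {suc k} {ps = []}     _       _          = here refl
∈-words {suc k} {ps = p ∷ ps} (s≤s l) (p≤m ∷ bd) =
  there (∈-cartesianProductWith⁺ _∷_ (∈-upTo⁺ (s≤s p≤m)) (∈-words l bd))

words-unique : ∀ k m → Unique (words k m)
words-unique zero    m = [] ∷ []
words-unique (suc k) m =
  All.tabulate (λ w∈ → nonempty w∈)
    ∷ Unique.cartesianProductWith⁺ _∷_ ∷-injective (Unique.upTo⁺ (suc m)) (words-unique k m)
  where
  nonempty : ∀ {w} → w ∈ cartesianProductWith _∷_ (upTo (suc m)) (words k m) → [] ≢ w
  nonempty w∈ refl with ∈-cartesianProductWith⁻ _∷_ (upTo (suc m)) (words k m) w∈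
  ... | _ , _ , _ , _ , ()

length≤sum : ∀ {ps} → All (_> 0) ps → length ps ≤ sum ps
length≤sum []          = z≤n
length≤sum (p>0 ∷ pos) = +-mono-≤ p>0 (length≤sum pos)

parts≤sum : ∀ ps → All (_≤ sum ps) ps
parts≤sum []       = []
parts≤sum (p ∷ ps) = m≤m+n p (sum ps) ∷ All.map (m≤n⇒m≤o+n p) (parts≤sum ps)

∈-regularPartitions : ∀ ℓ n ps → ps ∈ regularPartitions ℓ n ⇔ IsRegularPartition ℓ n ps
∈-regularPartitions ℓ n ps = mk⇔ to from
  where
  to : ps ∈ regularPartitions ℓ n → IsRegularPartition ℓ n ps
  to ps∈ = proj₂ (∈-filter⁻ (isRegularPartition? ℓ n) {xs = words n n} ps∈)

  ∈-words-total : IsPartition n ps → ps ∈ words n n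
  ∈-words-total (mkIsPartition pos _ refl) = ∈-words (length≤sum pos) (parts≤sum ps)

  from : IsRegularPartition ℓ n ps → ps ∈ regularPartitions ℓ n
  from p = ∈-filter⁺ (isRegularPartition? ℓ n) (∈-words-total (isPartition p)) p

regularPartitions-unique : ∀ ℓ n → Unique (regularPartitions ℓ n)
regularPartitions-unique ℓ n = Unique.filter⁺ (isRegularPartition? ℓ n) (words-unique n n)

{-# OPTIONS --safe #-}
module Submission where

-- Write f_k = ∏ (1 - q^(kj)) and θ = Σ_{k ∈ ℤ} q^(k(3k+1)/2), so that f_1 = θ modulo 2.  With B the
-- generating function of b_3 one has f_1 B = f_3, hence θ² B = θ(q) θ(q³) modulo 2.  As θ² = θ(q²), the
-- even part of the left side is θ(q²) times the even part of B.  Multiplication by units of ℤ[ω]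
-- identifies the even part of θ(q) θ(q³) with θ(q²)² Σ q^(2m²), the sum over m ≢ 2 (mod 3).
-- Cancelling θ(q²), b_3(2n) has the parity of the number of pairs (c, m) with m ≢ 2 (mod 3)
-- and (6c+1)² + 24 m² = 24n + 1.  If 29 divides 24n + 1 exactly once, multiplication by
-- -(25 ± 3√-24)/29, with the one sign that keeps coefficients integral, is an involution on these
-- pairs without fixed points.

-- The constants of the last step come from factoring 29. In ℤ[√-24] it splits as P P' with P not
-- principal: 29 is not of the form z² + 24m². The square of P or of P' is generated by 25 + 3√-24,
-- so the quotients P/P' and P'/P are generated by (25 ± 3√-24)/29. When 29 divides the norm of z +
-- m√-24 exactly once, exactly one of P, P' divides that number, and the involution trades this
-- factor for the other one. Hence exactly one sign keeps the coefficients integral, and the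
-- opposite sign leads back. The leading minus is forced by z ≡ 1 (mod 6), since -25 ≡ 29 (mod 6);
-- the same congruence modulo 3 keeps the class of m. Infinite sums and products never occur: the
-- theta identities are proved up to degree N with finite ranges, chosen large enough that no
-- solution is lost. Bijections are stated as decidable relations in which every element has exactly
-- one partner, because the partner arises from a division that is possible for only one choice of
-- sign.

-- Parity of finite lists, and counting by 0-1 matrices over 𝔽₂.

module Parity where

  open import Data.Bool.Base using (Bool; true; false; not; _xor_)
  open import Data.Bool.Properties using (xor-same; xor-assoc; xor-identityʳ)
  open import Data.Bool.Solver using (module xor-∧-Solver)
  open import Data.Empty using (⊥-elim)
  open import Data.List.Base using (List; []; _∷_; _++_; map; filter)
  open import Data.List.Membership.Propositional using (_∈_)
  open import Data.List.Relation.Unary.All as All using ([]; _∷_)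
  open import Data.List.Relation.Unary.AllPairs using ([]; _∷_)
  open import Data.List.Relation.Unary.Any using (here; there)
  open import Data.List.Relation.Unary.Unique.Propositional using (Unique)
  open import Data.Product.Base using (∃; _×_; _,_)
  open import Function.Base using (_∘_; const)
  open import Level using (0ℓ)
  open import Relation.Binary.PropositionalEquality
  open import Relation.Nullary.Decidable using (Dec; yes; no; does; dec-true; dec-false)
  open import Relation.Nullary.Negation using (¬_)
  open import Relation.Unary using (Pred; Decidable)

  private
    variable
      A B : Set

  ⨁ : List A → (A → Bool) → Bool
  ⨁ []       f = false
  ⨁ (x ∷ xs) f = f x xor ⨁ xs f

  odd : List A → Bool
  odd xs = ⨁ xs (const true)

  ⨁-cong : ∀ (xs : List A) {f g} → (∀ {x} → x ∈ xs → f x ≡ g x) → ⨁ xs f ≡ ⨁ xs g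
  ⨁-cong []       eq = refl
  ⨁-cong (x ∷ xs) eq = cong₂ _xor_ (eq (here refl)) (⨁-cong xs (eq ∘ there))

  ⨁-false : ∀ (xs : List A) → ⨁ xs (const false) ≡ false
  ⨁-false []       = refl
  ⨁-false (x ∷ xs) = ⨁-false xs

  ⨁-xor : ∀ (xs : List A) f g → ⨁ xs (λ x → f x xor g x) ≡ ⨁ xs f xor ⨁ xs g
  ⨁-xor []       f g = refl
  ⨁-xor (x ∷ xs) f g = trans (cong ((f x xor g x) xor_) (⨁-xor xs f g))
    (solve 4 (λ a b c d → (a :+ b) :+ (c :+ d) := (a :+ c) :+ (b :+ d)) refl (f x) (g x) _ _)
    where open xor-∧-Solver

  ⨁-++ : ∀ (xs ys : List A) f → ⨁ (xs ++ ys) f ≡ ⨁ xs f xor ⨁ ys f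
  ⨁-++ []       ys f = refl
  ⨁-++ (x ∷ xs) ys f = trans (cong (f x xor_) (⨁-++ xs ys f)) (sym (xor-assoc (f x) _ _))

  ⨁-map : ∀ (g : A → B) xs f → ⨁ (map g xs) f ≡ ⨁ xs (f ∘ g)
  ⨁-map g []       f = refl
  ⨁-map g (x ∷ xs) f = cong (f (g x) xor_) (⨁-map g xs f)

  ⨁-swap : ∀ (xs : List A) (ys : List B) (R : A → B → Bool) →
           ⨁ xs (λ x → ⨁ ys (R x)) ≡ ⨁ ys (λ y → ⨁ xs (λ x → R x y))
  ⨁-swap []       ys R = sym (⨁-false ys)
  ⨁-swap (x ∷ xs) ys R = trans (cong (⨁ ys (R x) xor_) (⨁-swap xs ys R)) (sym (⨁-xor ys _ _))

  -- Off the diagonal the entries of a symmetric matrix come in equal pairs, which cancel modulo 2.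
  ⨁-symmetric : ∀ (xs : List A) (R : A → A → Bool) → (∀ x y → R x y ≡ R y x) → (∀ {x} → x ∈ xs → R x x ≡ false) →
                ⨁ xs (λ x → ⨁ xs (R x)) ≡ false
  ⨁-symmetric []       R symm diag = refl
  ⨁-symmetric (x ∷ xs) R symm diag
    rewrite diag (here refl) | ⨁-xor xs (λ y → R y x) (λ y → ⨁ xs (R y))
          | ⨁-symmetric xs R symm (diag ∘ there)
          | xor-identityʳ (⨁ xs (λ y → R y x))
          | ⨁-cong xs {R x} (λ {y} _ → symm x y) = xor-same (⨁ xs (λ y → R y x))

  ⨁-filter : ∀ {P : Pred A 0ℓ} (P? : Decidable P) xs → ⨁ xs (does ∘ P?) ≡ odd (filter P? xs)
  ⨁-filter P? []       = refl
  ⨁-filter P? (x ∷ xs) with does (P? x)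
  ... | true  = cong not (⨁-filter P? xs)
  ... | false = ⨁-filter P? xs

  ⨁-none : ∀ {P : Pred A 0ℓ} (P? : Decidable P) xs → (∀ {x} → x ∈ xs → ¬ P x) →
           ⨁ xs (does ∘ P?) ≡ false
  ⨁-none P? xs none =
    trans (⨁-cong xs (λ {x} x∈ → dec-false (P? x) (none x∈))) (⨁-false xs)

  ExactlyOne : List A → Pred A 0ℓ → Set
  ExactlyOne xs P = ∃ λ x → x ∈ xs × P x × (∀ {y} → y ∈ xs → P y → y ≡ x)

  ⨁-exactlyOne : ∀ {P : Pred A 0ℓ} (P? : Decidable P) {xs} → Unique xs → ExactlyOne xs P →
                 ⨁ xs (does ∘ P?) ≡ true
  ⨁-exactlyOne P? {x ∷ xs} (x≢ ∷ u) (.x , here refl , px , only) =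
    cong₂ _xor_ (dec-true (P? x) px)
      (⨁-none P? xs (λ y∈ py → All.lookup x≢ y∈ (sym (only (there y∈) py))))
  ⨁-exactlyOne P? {x ∷ xs} (x≢ ∷ u) (z , there z∈ , pz , only) =
    cong₂ _xor_ (dec-false (P? x) (λ px → All.lookup x≢ z∈ (only (here refl) px)))
      (⨁-exactlyOne P? u (z , z∈ , pz , only ∘ there))

  -- Double counting: the matrix of `R` has one 1 in each row and one in each column, and its total
  -- is summed in both orders.
  odd-matching : ∀ {R : A → B → Set} (R? : ∀ x y → Dec (R x y)) {xs ys} → Unique xs → Unique ys →
                 (∀ {x} → x ∈ xs → ExactlyOne ys (R x)) →
                 (∀ {y} → y ∈ ys → ExactlyOne xs (λ x → R x y)) →
                 odd xs ≡ odd ys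
  odd-matching R? {xs} {ys} uxs uys rows cols = begin
    odd xs                                    ≡⟨ ⨁-cong xs (λ {x} x∈ → sym (⨁-exactlyOne (R? x) uys (rows x∈))) ⟩
    ⨁ xs (λ x → ⨁ ys (λ y → does (R? x y)))  ≡⟨ ⨁-swap xs ys _ ⟩
    ⨁ ys (λ y → ⨁ xs (λ x → does (R? x y)))  ≡⟨ ⨁-cong ys (λ {y} y∈ → ⨁-exactlyOne (λ x → R? x y) uxs (cols y∈)) ⟩
    odd ys                                    ∎
    where open ≡-Reasoning

  -- Each row of the matrix of `R` has a single 1, so the total is the parity of `xs`; symmetry and
  -- the empty diagonal make that total even.
  odd-involution : ∀ {R : A → A → Set} (R? : ∀ x y → Dec (R x y)) {xs} → Unique xs →
                   (∀ {x y} → R x y → R y x) → (∀ {x} → ¬ R x x) →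
                   (∀ {x} → x ∈ xs → ExactlyOne xs (R x)) →
                   odd xs ≡ false
  odd-involution R? {xs} uxs symm irr rows =
    trans (⨁-cong xs (λ {x} x∈ → sym (⨁-exactlyOne (R? x) uxs (rows x∈))))
          (⨁-symmetric xs (λ x y → does (R? x y)) symm? (λ {x} _ → dec-false (R? x x) irr))
    where
    symm? : ∀ x y → does (R? x y) ≡ does (R? y x)
    symm? x y with R? x y | R? y x
    ... | yes _ | yes _  = refl
    ... | no _  | no _   = refl
    ... | yes r | no ¬r  = ⊥-elim (¬r (symm r))
    ... | no ¬r | yes r  = ⊥-elim (¬r (symm r))

  odd-sameElements : ∀ (_≟_ : ∀ (x y : A) → Dec (x ≡ y)) {xs ys} → Unique xs → Unique ys →
                     (∀ {x} → x ∈ xs → x ∈ ys) → (∀ {x} → x ∈ ys → x ∈ xs) → odd xs ≡ odd ys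
  odd-sameElements _≟_ uxs uys to from = odd-matching _≟_ uxs uys
    (λ {x} x∈ → x , to x∈ , refl , λ _ → sym)
    (λ {y} y∈ → y , from y∈ , refl , λ _ eq → eq)

-- Formal power series over 𝔽₂ and their truncations.

module PowerSeries where

  open import Algebra.Bundles using (CommutativeRing)
  open import Data.Bool.Base using (Bool; true; false; _∧_; _xor_)
  open import Data.Bool.Properties using (xor-same; xor-assoc; xor-comm; xor-identityʳ; ∧-zeroʳ)
  open import Data.Bool.Solver using (module xor-∧-Solver)
  open import Data.Nat.Base as ℕ using (ℕ; zero; suc; _+_; _≤_; _<_; _≡ᵇ_; z≤n; s≤s)
  import Data.Nat.Properties as ℕ
  open import Data.Product.Base using (_,_)
  open import Function.Base using (_∘_; id)
  open import Level using (0ℓ)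
  open import Relation.Binary.PropositionalEquality

  -- Formal power series over 𝔽₂.
  Series : Set
  Series = ℕ → Bool

  infixl 6 _⊞_
  infixl 7 _⊠_

  tail : Series → Series
  tail f n = f (suc n)

  𝟘 𝟙 : Series
  𝟘 _       = false
  𝟙 zero    = true
  𝟙 (suc _) = false

  _⊞_ : Series → Series → Series
  (f ⊞ g) n = f n xor g n

  -- The Cauchy product by recursion on f = f(0) + q · `tail f`, which spares sums over index
  -- ranges.
  _⊠_ : Series → Series → Series
  (f ⊠ g) zero    = f zero ∧ g zero
  (f ⊠ g) (suc n) = (f zero ∧ g (suc n)) xor (tail f ⊠ g) n

  open xor-∧-Solver using (solve; _:+_; _:*_; _:=_)

  -- Coefficient n of a product sees only coefficients up to n; with these bounds the product is
  -- well defined on truncated series.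
  ⊠-cong : ∀ n {f f′ g g′} → (∀ {i} → i ≤ n → f i ≡ f′ i) → (∀ {i} → i ≤ n → g i ≡ g′ i) →
           (f ⊠ g) n ≡ (f′ ⊠ g′) n
  ⊠-cong zero    ff gg = cong₂ _∧_ (ff z≤n) (gg z≤n)
  ⊠-cong (suc n) ff gg =
    cong₂ _xor_ (cong₂ _∧_ (ff z≤n) (gg ℕ.≤-refl)) (⊠-cong n (ff ∘ s≤s) (gg ∘ ℕ.m≤n⇒m≤1+n))

  ⊠-zeroˡ : ∀ g n → (𝟘 ⊠ g) n ≡ false
  ⊠-zeroˡ g zero    = refl
  ⊠-zeroˡ g (suc n) = ⊠-zeroˡ g n

  ⊠-identityˡ : ∀ g n → (𝟙 ⊠ g) n ≡ g n
  ⊠-identityˡ g zero    = refl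
  ⊠-identityˡ g (suc n) = trans (cong (g (suc n) xor_) (⊠-zeroˡ g n)) (xor-identityʳ _)

  ⊠-distribʳ : ∀ h f g n → ((f ⊞ g) ⊠ h) n ≡ (f ⊠ h) n xor (g ⊠ h) n
  ⊠-distribʳ h f g zero    = solve 3 (λ a b c → (a :+ b) :* c := a :* c :+ b :* c) refl (f 0) (g 0) (h 0)
  ⊠-distribʳ h f g (suc n) =
    trans (cong (((f 0 xor g 0) ∧ h (suc n)) xor_) (⊠-distribʳ h (tail f) (tail g) n))
      (solve 5 (λ a b c d e → (a :+ b) :* c :+ (d :+ e) := (a :* c :+ d) :+ (b :* c :+ e)) refl
        (f 0) (g 0) (h (suc n)) _ _)

  ⊠-scaleˡ : ∀ c f g n → ((λ i → c ∧ f i) ⊠ g) n ≡ c ∧ (f ⊠ g) n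
  ⊠-scaleˡ c f g zero    = solve 3 (λ c a b → (c :* a) :* b := c :* (a :* b)) refl c (f 0) (g 0)
  ⊠-scaleˡ c f g (suc n) =
    trans (cong (((c ∧ f 0) ∧ g (suc n)) xor_) (⊠-scaleˡ c (tail f) g n))
      (solve 4 (λ c a b d → (c :* a) :* b :+ c :* d := c :* (a :* b :+ d)) refl c (f 0) (g (suc n)) _)

  ⊠-assoc : ∀ f g h n → ((f ⊠ g) ⊠ h) n ≡ (f ⊠ (g ⊠ h)) n
  ⊠-assoc f g h zero    = solve 3 (λ a b c → (a :* b) :* c := a :* (b :* c)) refl (f 0) (g 0) (h 0)
  ⊠-assoc f g h (suc n)
    rewrite ⊠-distribʳ h (λ i → f 0 ∧ tail g i) (tail f ⊠ g) n
          | ⊠-scaleˡ (f 0) (tail g) h n | ⊠-assoc (tail f) g h n =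
    solve 5 (λ a b c d e → (a :* b) :* c :+ (a :* d :+ e) := a :* (b :* c :+ d) :+ e) refl
      (f 0) (g 0) (h (suc n)) _ _

  ⊠-sucʳ : ∀ f g n → (f ⊠ g) (suc n) ≡ (f (suc n) ∧ g 0) xor (f ⊠ tail g) n
  ⊠-sucʳ f g zero    = xor-comm (f 0 ∧ g 1) (f 1 ∧ g 0)
  ⊠-sucʳ f g (suc n) rewrite ⊠-sucʳ (tail f) g n =
    solve 3 (λ a b c → a :+ (b :+ c) := b :+ (a :+ c)) refl (f 0 ∧ g (suc (suc n))) (f (suc (suc n)) ∧ g 0) _

  ⊠-comm : ∀ f g n → (f ⊠ g) n ≡ (g ⊠ f) n
  ⊠-comm f g zero    = solve 2 (λ a b → a :* b := b :* a) refl (f 0) (g 0)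
  ⊠-comm f g (suc n) rewrite ⊠-sucʳ g f n | ⊠-comm (tail f) g n =
    solve 3 (λ a b c → a :* b :+ c := b :* a :+ c) refl (f 0) (g (suc n)) _

  -- The lowest coefficient of `g` vanishes, so f g is q times f · `tail g`, and the induction
  -- continues with `tail g`.
  ⊠≡0⇒≡0 : ∀ n f g → f 0 ≡ true → (∀ {i} → i ≤ n → (f ⊠ g) i ≡ false) → g n ≡ false
  ⊠≡0⇒≡0 zero    f g f₀ fg = trans (sym (cong (_∧ g 0) f₀)) (fg z≤n)
  ⊠≡0⇒≡0 (suc n) f g f₀ fg = ⊠≡0⇒≡0 n f (tail g) f₀ (λ {i} i≤n → begin
      (f ⊠ tail g) i                          ≡⟨ cong (_xor (f ⊠ tail g) i) (∧-zeroʳ (f (suc i))) ⟨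
      (f (suc i) ∧ false) xor (f ⊠ tail g) i  ≡⟨ cong (λ c → (f (suc i) ∧ c) xor (f ⊠ tail g) i) g₀ ⟨
      (f (suc i) ∧ g 0) xor (f ⊠ tail g) i    ≡⟨ ⊠-sucʳ f g i ⟨
      (f ⊠ g) (suc i)                         ≡⟨ fg (s≤s i≤n) ⟩
      false                                   ∎)
    where
    open ≡-Reasoning
    g₀ : g 0 ≡ false
    g₀ = ⊠≡0⇒≡0 0 f g f₀ (λ { z≤n → fg z≤n })

  xor≡false⇒≡ : ∀ a b → a xor b ≡ false → a ≡ b
  xor≡false⇒≡ false b eq = sym eq
  xor≡false⇒≡ true true eq = refl

  ⊠-cancelˡ : ∀ n f g h → f 0 ≡ true → (∀ {i} → i ≤ n → (f ⊠ g) i ≡ (f ⊠ h) i) → g n ≡ h n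
  ⊠-cancelˡ n f g h f₀ eq = xor≡false⇒≡ (g n) (h n)
    (⊠≡0⇒≡0 n f (g ⊞ h) f₀ (λ {i} i≤n → begin
      (f ⊠ (g ⊞ h)) i              ≡⟨ ⊠-comm f (g ⊞ h) i ⟩
      ((g ⊞ h) ⊠ f) i              ≡⟨ ⊠-distribʳ f g h i ⟩
      (g ⊠ f) i xor (h ⊠ f) i      ≡⟨ cong₂ _xor_ (⊠-comm g f i) (⊠-comm h f i) ⟩
      (f ⊠ g) i xor (f ⊠ h) i      ≡⟨ cong (_xor (f ⊠ h) i) (eq i≤n) ⟩
      (f ⊠ h) i xor (f ⊠ h) i      ≡⟨ xor-same ((f ⊠ h) i) ⟩
      false                        ∎))
    where open ≡-Reasoning

  double : ℕ → ℕ
  double zero    = zero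
  double (suc n) = suc (suc (double n))

  ⊠-leftComm : ∀ f g h n → (f ⊠ (g ⊠ h)) n ≡ (g ⊠ (f ⊠ h)) n
  ⊠-leftComm f g h n = begin
    (f ⊠ (g ⊠ h)) n  ≡⟨ ⊠-assoc f g h n ⟨
    ((f ⊠ g) ⊠ h) n  ≡⟨ ⊠-cong n (λ {i} _ → ⊠-comm f g i) (λ _ → refl) ⟩
    ((g ⊠ f) ⊠ h) n  ≡⟨ ⊠-assoc g f h n ⟩
    (g ⊠ (f ⊠ h)) n  ∎
    where open ≡-Reasoning

  -- f² = f(q²) over 𝔽₂, so multiplication by f² acts on even coefficients as multiplication by f.
  even-frobenius : ∀ f g n → (f ⊠ (f ⊠ g)) (double n) ≡ (f ⊠ (g ∘ double)) n
  even-frobenius f g zero with f 0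
  ... | true  = refl
  ... | false = refl
  even-frobenius f g (suc n) =
    trans (cong (λ c → (f 0 ∧ (f ⊠ g) (double (suc n))) xor c)
            -- Commuting the factors lets the second `f` be split as well. The cross term f(0) ·
            -- (`tail f` ⊠ g) then occurs twice, and `cancel` removes it.
            (trans (⊠-leftComm (tail f) f g (suc (double n)))
                   (cong ((f 0 ∧ (tail f ⊠ g) (suc (double n))) xor_) (even-frobenius (tail f) g n))))
          (cancel (f 0) (g (double (suc n))) ((tail f ⊠ g) (suc (double n))) ((tail f ⊠ (g ∘ double)) n))
    where
    cancel : ∀ a b c d → (a ∧ (a ∧ b xor c)) xor ((a ∧ c) xor d) ≡ (a ∧ b) xor d
    cancel false b c d = refl
    cancel true  b c d = begin
      (b xor c) xor (c xor d)  ≡⟨ xor-assoc b c (c xor d) ⟩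
      b xor (c xor (c xor d))  ≡⟨ cong (b xor_) (xor-assoc c c d) ⟨
      b xor ((c xor c) xor d)  ≡⟨ cong (λ x → b xor (x xor d)) (xor-same c) ⟩
      b xor d                  ∎
      where open ≡-Reasoning

  -- The ring 𝔽₂[[q]]/(q^(N+1)), kept on the same carrier with a coarser equality. In it q^e is zero
  -- for e > N, so finite sums and products can stand for θ and for the infinite products.
  truncated : ℕ → CommutativeRing 0ℓ 0ℓ
  truncated N = record
    { Carrier = Series
    ; _≈_ = λ f g → ∀ n → n ≤ N → f n ≡ g n
    ; _+_ = _⊞_
    ; _*_ = _⊠_
    ; -_  = id
    ; 0#  = 𝟘
    ; 1#  = 𝟙
    ; isCommutativeRing = record
      { isRing = record
        { +-isAbelianGroup = record
          { isGroup = record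
            { isMonoid = record
              { isSemigroup = record
                { isMagma = record
                  { isEquivalence = record
                    { refl  = λ _ _ → refl
                    ; sym   = λ p n le → sym (p n le)
                    ; trans = λ p q n le → trans (p n le) (q n le)
                    }
                  ; ∙-cong = λ p q n le → cong₂ _xor_ (p n le) (q n le)
                  }
                ; assoc = λ f g h n _ → xor-assoc (f n) (g n) (h n)
                }
              ; identity = (λ _ _ _ → refl) , (λ f n _ → xor-identityʳ (f n))
              }
            ; inverse = (λ f n _ → xor-same (f n)) , (λ f n _ → xor-same (f n))
            ; ⁻¹-cong = id
            }
          ; comm = λ f g n _ → xor-comm (f n) (g n)
          }
        ; *-cong = λ p q n le → ⊠-cong n (λ i≤n → p _ (ℕ.≤-trans i≤n le)) (λ i≤n → q _ (ℕ.≤-trans i≤n le))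
        ; *-assoc = λ f g h n _ → ⊠-assoc f g h n
        ; *-identity = (λ f n _ → ⊠-identityˡ f n)
                     , (λ f n _ → trans (⊠-comm f 𝟙 n) (⊠-identityˡ f n))
        ; distrib = (λ f g h n _ → trans (⊠-comm f (g ⊞ h) n)
                                     (trans (⊠-distribʳ f g h n) (cong₂ _xor_ (⊠-comm g f n) (⊠-comm h f n))))
                  , (λ f g h n _ → ⊠-distribʳ f g h n)
        }
      ; *-comm = λ f g n _ → ⊠-comm f g n
      }
    }

  X : ℕ → Series
  X e n = e ≡ᵇ n

  X-0 : ∀ n → X 0 n ≡ 𝟙 n
  X-0 zero    = refl
  X-0 (suc n) = refl

  X-+ : ∀ a b n → X (a + b) n ≡ (X a ⊠ X b) n
  X-+ zero    b n       = sym (trans (⊠-cong n (λ {i} _ → X-0 i) (λ _ → refl)) (⊠-identityˡ (X b) n))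
  X-+ (suc a) b zero    = refl
  X-+ (suc a) b (suc n) = X-+ a b n

  X-⊠-< : ∀ e f n → n < e → (X e ⊠ f) n ≡ false
  X-⊠-< (suc e) f zero    _         = refl
  X-⊠-< (suc e) f (suc n) (s≤s n<e) = X-⊠-< e f n n<e

  X-⊠-≥ : ∀ e f n → (X e ⊠ f) (e + n) ≡ f n
  X-⊠-≥ zero    f n = trans (⊠-cong n (λ {i} _ → X-0 i) (λ _ → refl)) (⊠-identityˡ f n)
  X-⊠-≥ (suc e) f n = X-⊠-≥ e f n

-- Shanks' finite pentagonal number identity in characteristic 2.

module PentagonalNumbers where

  open import Algebra.Bundles using (CommutativeRing)
  import Algebra.Solver.Ring.NaturalCoefficients.Default as NatSolver
  open import Data.Integer.Base using (ℤ; +_; -[1+_])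
  open import Data.List.Base using (List; []; _∷_; _++_; map; cartesianProduct)
  open import Data.Nat.Base as ℕ using (ℕ; zero; suc; _+_; _*_; _≤_; _<_; z≤n; s≤s)
  import Data.Nat.Properties as ℕ
  open import Data.Product.Base using (_,_)
  open import Function.Base using (_∘_)
  open import Relation.Binary.PropositionalEquality as ≡ using (_≡_)

  triangle : ℕ → ℕ
  triangle zero    = 0
  triangle (suc n) = suc n + triangle n

  -- pentagonal k = k (3k + 1) / 2
  pentagonal : ℤ → ℕ
  pentagonal (+ n)    = n * n + triangle n
  pentagonal -[1+ n ] = suc n * suc n + triangle n

  -- The integers from -n to n, ordered so that passing to `suc n` puts exactly the two indices of a
  -- new `pair` in front.
  interval : ℕ → List ℤ
  interval zero    = + 0 ∷ []
  interval (suc n) = + suc n ∷ -[1+ n ] ∷ interval n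

  module Sum {c ℓ} (R : CommutativeRing c ℓ) where
    open CommutativeRing R hiding (zero)
      renaming (_+_ to _⊕_; _*_ to _⊗_; +-cong to ⊕-cong; *-cong to ⊗-cong)
    open NatSolver commutativeSemiring
    open import Relation.Binary.Reasoning.Setoid setoid

    ∑ : ∀ {A : Set} → List A → (A → Carrier) → Carrier
    ∑ []       f = 0#
    ∑ (x ∷ xs) f = f x ⊕ ∑ xs f

    ∑-cong : ∀ {A : Set} (xs : List A) {f g} → (∀ x → f x ≈ g x) → ∑ xs f ≈ ∑ xs g
    ∑-cong []       eq = refl
    ∑-cong (x ∷ xs) eq = ⊕-cong (eq x) (∑-cong xs eq)

    ∑-++ : ∀ {A : Set} (xs ys : List A) f → ∑ (xs ++ ys) f ≈ ∑ xs f ⊕ ∑ ys f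
    ∑-++ []       ys f = sym (+-identityˡ _)
    ∑-++ (x ∷ xs) ys f = trans (+-congˡ (∑-++ xs ys f)) (sym (+-assoc _ _ _))

    ∑-map-⊗ : ∀ {A B : Set} (x : A) (ys : List B) (f : A → Carrier) (g : B → Carrier) →
              ∑ (map (x ,_) ys) (λ (a , b) → f a ⊗ g b) ≈ f x ⊗ ∑ ys g
    ∑-map-⊗ x []       f g = sym (zeroʳ (f x))
    ∑-map-⊗ x (y ∷ ys) f g = trans (+-congˡ (∑-map-⊗ x ys f g)) (sym (distribˡ _ _ _))

    ∑-⊗-∑ : ∀ {A B : Set} (xs : List A) (ys : List B) (f : A → Carrier) (g : B → Carrier) →
            ∑ xs f ⊗ ∑ ys g ≈ ∑ (cartesianProduct xs ys) (λ (a , b) → f a ⊗ g b)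
    ∑-⊗-∑ []       ys f g = zeroˡ _
    ∑-⊗-∑ (x ∷ xs) ys f g = begin
      (f x ⊕ ∑ xs f) ⊗ ∑ ys g          ≈⟨ distribʳ _ _ _ ⟩
      f x ⊗ ∑ ys g ⊕ ∑ xs f ⊗ ∑ ys g   ≈⟨ ⊕-cong (sym (∑-map-⊗ x ys f g)) (∑-⊗-∑ xs ys f g) ⟩
      _                                ≈⟨ ∑-++ (map (x ,_) ys) _ _ ⟨
      ∑ (cartesianProduct (x ∷ xs) ys) (λ (a , b) → f a ⊗ g b) ∎

    module Characteristic2 (x⊕x≈0 : ∀ x → x ⊕ x ≈ 0#) where

      cancel-pair : ∀ a b → a ⊕ (b ⊕ b) ≈ a
      cancel-pair a b = trans (+-congˡ (x⊕x≈0 b)) (+-identityʳ a)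

      ∑-square : ∀ {A : Set} (xs : List A) f → ∑ xs f ⊗ ∑ xs f ≈ ∑ xs (λ x → f x ⊗ f x)
      ∑-square []       f = zeroˡ 0#
      ∑-square (x ∷ xs) f = begin
        (f x ⊕ ∑ xs f) ⊗ (f x ⊕ ∑ xs f)
          ≈⟨ solve 2 (λ a b → (a :+ b) :* (a :+ b) := (a :* a :+ b :* b) :+ (a :* b :+ a :* b)) refl _ _ ⟩
        (f x ⊗ f x ⊕ ∑ xs f ⊗ ∑ xs f) ⊕ (f x ⊗ ∑ xs f ⊕ f x ⊗ ∑ xs f)
          ≈⟨ cancel-pair _ _ ⟩
        f x ⊗ f x ⊕ ∑ xs f ⊗ ∑ xs f
          ≈⟨ +-congˡ (∑-square xs f) ⟩
        f x ⊗ f x ⊕ ∑ xs (λ x → f x ⊗ f x) ∎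

      -- Shanks' finite form of the pentagonal number theorem; x e stands for the e-th power of x.
      module Pentagonal (x : ℕ → Carrier) (x-0 : x 0 ≈ 1#) (x-+ : ∀ a b → x (a + b) ≈ x a ⊗ x b) where

        -- The product of 1 + q^i over s < i ≤ s + d. A variable lower end is needed for the partial
        -- products in `remainder`.
        euler : ℕ → ℕ → Carrier
        euler s zero    = 1#
        euler s (suc d) = (1# ⊕ x (suc s)) ⊗ euler (suc s) d

        euler-sucʳ : ∀ s d → euler s (suc d) ≈ euler s d ⊗ (1# ⊕ x (suc (s + d)))
        euler-sucʳ s zero rewrite ℕ.+-identityʳ s = *-comm _ _
        euler-sucʳ s (suc d) rewrite ℕ.+-suc s d =
          trans (*-congˡ (euler-sucʳ (suc s) d)) (sym (*-assoc _ _ _))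

        -- With n = s + d, the terms j = s+1, ..., n of Shanks' sum of q^(jn + j(j+1)/2) ∏ (1 +
        -- q^i), the product over j < i ≤ n. The term j = 0 is `euler 0 n`.
        remainder : ℕ → ℕ → Carrier
        remainder s zero    = 0#
        remainder s (suc d) = euler (suc s) d ⊗ x (suc s * suc (s + d) + triangle (suc s)) ⊕ remainder (suc s) d

        pair : ℕ → Carrier
        pair n = x (pentagonal (+ suc n)) ⊕ x (pentagonal -[1+ n ])

        -- The change from n = s + d to n + 1 telescopes over the terms: what is left is one
        -- boundary term at the lower end `s` and the two new pentagonal powers. At s = 0 the
        -- boundary term is the increment of `euler 0 n`.
        remainder-suc : ∀ s d → remainder s (suc d) ≈
          (remainder s d ⊕ euler s d ⊗ x (suc s * suc (s + d) + triangle s)) ⊕ pair (s + d)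
        -- The boundary term coincides with the half of `pair s` of negative index and cancels it.
        remainder-suc s zero rewrite ℕ.+-identityʳ s =
          trans (solve 2 (λ a b → con 1 :* a :+ con 0 := a :+ con 0) refl _ 0#)
            (trans (+-congˡ (sym (x⊕x≈0 _)))
               (solve 2 (λ a b → a :+ (b :+ b) := (con 0 :+ con 1 :* b) :+ (a :+ b)) refl _ _))
        remainder-suc s (suc d) rewrite ℕ.+-suc s d = begin
          euler (suc s) (suc d) ⊗ x (suc s * suc n + triangle (suc s)) ⊕ remainder (suc s) (suc d)
            ≈⟨ ⊕-cong (⊗-cong (euler-sucʳ (suc s) d) x₁) (trans (remainder-suc (suc s) d)
                 (+-congʳ (+-congˡ (*-congˡ x₂)))) ⟩
          g ⊗ (1# ⊕ z) ⊗ (y ⊗ w) ⊕ ((rem ⊕ g ⊗ (z ⊗ (y ⊗ w))) ⊕ pair n)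
            ≈⟨ solve 6 (λ g z y w r p →
                 g :* (con 1 :+ z) :* (y :* w) :+ ((r :+ g :* (z :* (y :* w))) :+ p) :=
                 (g :* (y :* w) :+ r :+ p) :+ (g :* (z :* (y :* w)) :+ g :* (z :* (y :* w))))
                 refl g z y w rem (pair n) ⟩
          _ ≈⟨ cancel-pair _ _ ⟩
          g ⊗ (y ⊗ w) ⊕ rem ⊕ pair n
            -- Of the two inserted copies of g y, one is the first term of `remainder s (suc d)`, by
            -- `e₃`; the other joins g y w to form (1 + w) g y, the boundary term at `s`.
            ≈⟨ cancel-pair _ (g ⊗ y) ⟨
          _ ≈⟨ solve 5 (λ g y w r p →
                 (g :* (y :* w) :+ r :+ p) :+ (g :* y :+ g :* y) :=
                 ((g :* y :+ r) :+ ((con 1 :+ w) :* g) :* y) :+ p)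
                 refl g y w rem (pair n) ⟩
          ((g ⊗ y ⊕ rem) ⊕ (1# ⊕ w) ⊗ g ⊗ y) ⊕ pair n
            ≈⟨ +-congʳ (+-congʳ (+-congʳ (*-congˡ (reflexive (≡.cong x e₃))))) ⟨
          _ ∎
          where
          n   = suc (s + d)
          g   = euler (suc s) d
          z   = x (suc n)
          w   = x (suc s)
          y   = x (suc s * suc n + triangle s)
          rem = remainder (suc s) d
          e₁ : suc s * suc n + triangle (suc s) ≡ (suc s * suc n + triangle s) + suc s
          e₁ = ≡.trans (≡.cong (_+_ (suc s * suc n)) (ℕ.+-comm (suc s) (triangle s)))
                       (≡.sym (ℕ.+-assoc (suc s * suc n) (triangle s) (suc s)))
          x₁ : x (suc s * suc n + triangle (suc s)) ≈ y ⊗ w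
          x₁ = trans (reflexive (≡.cong x e₁)) (x-+ _ _)
          x₂ : x (suc (suc s) * suc n + triangle (suc s)) ≈ z ⊗ (y ⊗ w)
          x₂ = trans (reflexive (≡.cong x (ℕ.+-assoc (suc n) (suc s * suc n) (triangle (suc s)))))
                 (trans (x-+ _ _) (*-congˡ x₁))
          e₃ : suc s * n + triangle (suc s) ≡ suc s * suc n + triangle s
          e₃ = ≡.trans (≡.sym (ℕ.+-assoc (suc s * n) (suc s) (triangle s)))
                 (≡.cong (_+ triangle s)
                   (≡.trans (ℕ.+-comm (suc s * n) (suc s)) (≡.sym (ℕ.*-suc (suc s) n))))

        -- From n to n + 1, `euler 0` and `remainder 0` change by the same boundary term, up to the
        -- two powers that the theta sum gains.
        euler≈∑+remainder : ∀ n → euler 0 n ≈ ∑ (interval n) (x ∘ pentagonal) ⊕ remainder 0 n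
        euler≈∑+remainder zero =
          trans (sym x-0) (sym (trans (+-identityʳ _) (+-identityʳ _)))
        euler≈∑+remainder (suc n) = begin
          euler 0 (suc n)
            ≈⟨ euler-sucʳ 0 n ⟩
          euler 0 n ⊗ (1# ⊕ x (suc n))
            ≈⟨ solve 2 (λ a b → a :* (con 1 :+ b) := a :+ a :* b) refl _ _ ⟩
          euler 0 n ⊕ euler 0 n ⊗ x (suc n)
            ≈⟨ +-congʳ (euler≈∑+remainder n) ⟩
          (theta ⊕ remainder 0 n) ⊕ euler 0 n ⊗ x (suc n)
            ≈⟨ cancel-pair _ (pair n) ⟨
          ((theta ⊕ remainder 0 n) ⊕ euler 0 n ⊗ x (suc n)) ⊕ (pair n ⊕ pair n)
            ≈⟨ solve 5 (λ t r e a b → ((t :+ r) :+ e) :+ ((a :+ b) :+ (a :+ b)) :=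
                   (a :+ (b :+ t)) :+ ((r :+ e) :+ (a :+ b))) refl _ _ _ _ _ ⟩
          ∑ (interval (suc n)) (x ∘ pentagonal) ⊕ ((remainder 0 n ⊕ euler 0 n ⊗ x (suc n)) ⊕ pair n)
            ≈⟨ +-congˡ (trans (remainder-suc 0 n) (+-congʳ (+-congˡ (*-congˡ (reflexive (≡.cong x e)))))) ⟨
          ∑ (interval (suc n)) (x ∘ pentagonal) ⊕ remainder 0 (suc n) ∎
          where
          theta = ∑ (interval n) (x ∘ pentagonal)
          e : suc (n + 0) + 0 ≡ suc n
          e = ≡.trans (ℕ.+-identityʳ _) (≡.cong suc (ℕ.+-identityʳ n))

        -- Every term has index j ≥ 1, so its exponent jn + j(j+1)/2 exceeds n = s + d.
        remainder≈0 : ∀ s d → (∀ e → s + d < e → x e ≈ 0#) → remainder s d ≈ 0#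
        remainder≈0 s zero    vanish = refl
        remainder≈0 s (suc d) vanish rewrite ℕ.+-suc s d =
          trans (⊕-cong (trans (*-congˡ (vanish _ large)) (zeroʳ _)) (remainder≈0 (suc s) d vanish))
                (+-identityˡ 0#)
          where
          large : suc (s + d) < suc s * suc (s + d) + triangle (suc s)
          large = ≡.subst (_≤ suc s * suc (s + d) + triangle (suc s)) (ℕ.+-comm (suc (s + d)) 1)
                    (ℕ.+-mono-≤ (ℕ.m≤n*m (suc (s + d)) (suc s)) (s≤s z≤n))

        euler≈∑ : ∀ n → (∀ e → n < e → x e ≈ 0#) → euler 0 n ≈ ∑ (interval n) (x ∘ pentagonal)
        euler≈∑ n vanish =
          trans (euler≈∑+remainder n) (trans (+-congˡ (remainder≈0 0 n vanish)) (+-identityʳ _))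

-- Recursion for regular partitions by their largest part.

module RegularPartitions where

  open import Defs
  open import Data.Bool.Base using (false; _xor_)
  open import Data.Bool.Properties using (xor-assoc; xor-same; xor-identityʳ)
  open import Data.Empty using (⊥-elim)
  open import Data.List.Base using (List; []; _∷_; _++_; map; length)
  open import Data.List.Membership.Propositional using (_∈_)
  open import Data.List.Membership.Propositional.Properties
    using (∈-++⁺ˡ; ∈-++⁺ʳ; ∈-++⁻; ∈-map⁺; ∈-map⁻)
  import Data.List.Properties as List
  open import Data.List.Relation.Unary.All as All using (All; []; _∷_)
  open import Data.List.Relation.Unary.AllPairs using ([]; _∷_)
  open import Data.List.Relation.Unary.Any using (here)
  open import Data.List.Relation.Unary.Linked as Linked using (Linked; []; [-]; _∷_)
  open import Data.List.Relation.Unary.Unique.Propositional using (Unique)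
  import Data.List.Relation.Unary.Unique.Propositional.Properties as Unique
  open import Data.Nat.Base
  open import Data.Nat.Divisibility using (_∣_; _∤_; _∣?_)
  open import Data.Nat.Properties
  open import Data.Product.Base using (∃; _×_; _,_; proj₂)
  open import Data.Sum.Base using (_⊎_; inj₁; inj₂)
  open import Function.Base using (_∘_)
  open import Function.Bundles using (Equivalence)
  open import Relation.Binary.PropositionalEquality
  open import Relation.Nullary.Decidable using (yes; no)
  open import Relation.Nullary.Negation using (¬_)
  open Parity
  open PowerSeries

  module _ (ℓ : ℕ) where

    record BoundedPartition (k m n : ℕ) (ps : List ℕ) : Set where
      constructor bounded
      field
        partition : IsRegularPartition ℓ n ps
        length≤   : length ps ≤ k
        parts≤    : All (_≤ m) ps

    open BoundedPartition

    -- A second enumeration, split by whether `suc m` is the largest part; filtering `words` offers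
    -- no such recursion. Since a part may repeat, the part bound stays when one is removed, and the
    -- bound `k` on the number of parts is what decreases.
    partitions : (k m n : ℕ) → List (List ℕ)
    withLargest : (k m n : ℕ) → List (List ℕ)

    partitions k zero    zero    = [] ∷ []
    partitions k zero    (suc n) = []
    partitions k (suc m) n       = partitions k m n ++ withLargest k m n

    withLargest zero    m n = []
    withLargest (suc k) m n with ℓ ∣? suc m | suc m ≤? n
    ... | no _  | yes _ = map (suc m ∷_) (partitions k (suc m) (n ∸ suc m))
    ... | _     | _     = []

    partitions⁻ : ∀ k m n {ps} → ps ∈ partitions k m n → BoundedPartition k m n ps
    withLargest⁻ : ∀ k m n {ps} → ps ∈ withLargest k m n →
                   ∃ λ qs → ps ≡ suc m ∷ qs × BoundedPartition k (suc m) n ps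

    partitions⁻ k zero    zero    (here refl) =
      bounded (mkIsRegularPartition (mkIsPartition [] [] refl) []) z≤n []
    partitions⁻ k (suc m) n p∈ with ∈-++⁻ (partitions k m n) p∈
    ... | inj₁ p∈′ with partitions⁻ k m n p∈′
    ...   | bounded p l b = bounded p l (All.map m≤n⇒m≤1+n b)
    partitions⁻ k (suc m) n p∈ | inj₂ p∈′ = proj₂ (proj₂ (withLargest⁻ k m n p∈′))

    withLargest⁻ (suc k) m n p∈ with ℓ ∣? suc m | suc m ≤? n
    ... | no ∤m | yes m≤n with ∈-map⁻ (suc m ∷_) p∈
    ...   | qs , q∈ , refl with partitions⁻ k (suc m) (n ∸ suc m) q∈
    ...     | bounded (mkIsRegularPartition (mkIsPartition pos dec tot) reg) l b =
      qs , refl , bounded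
        (mkIsRegularPartition
          (mkIsPartition (s≤s z≤n ∷ pos) (link b dec) (trans (cong (suc m +_) tot) (m+[n∸m]≡n m≤n)))
          (∤m ∷ reg))
        (s≤s l) (≤-refl ∷ b)
      where
      link : ∀ {x qs} → All (_≤ x) qs → Linked _≥_ qs → Linked _≥_ (x ∷ qs)
      link []      []  = [-]
      link (b ∷ _) l   = b ∷ l

    parts≤head : ∀ {p ps} → Linked _≥_ (p ∷ ps) → All (_≤ p) ps
    parts≤head [-]      = []
    parts≤head (b ∷ l)  = b ∷ All.map (λ le → ≤-trans le b) (parts≤head l)

    partitions⁺ : ∀ k m n {ps} → BoundedPartition k m n ps → ps ∈ partitions k m n
    withLargest⁺ : ∀ k m n {ps} → BoundedPartition k (suc m) n (suc m ∷ ps) → suc m ∷ ps ∈ withLargest k m n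

    partitions⁺ k zero n {[]} (bounded (mkIsRegularPartition (mkIsPartition _ _ refl) _) _ _) = here refl
    partitions⁺ k zero n {p ∷ ps} (bounded (mkIsRegularPartition (mkIsPartition (p>0 ∷ _) _ _) _) _ (p≤0 ∷ _)) =
      ⊥-elim (<⇒≱ p>0 p≤0)
    partitions⁺ k (suc m) n {[]} (bounded p l []) = ∈-++⁺ˡ (partitions⁺ k m n (bounded p l []))
    partitions⁺ k (suc m) n {p ∷ ps} bp@(bounded r l (p≤ ∷ b)) with m≤n⇒m<n∨m≡n p≤
    ... | inj₁ (s≤s p≤m) = ∈-++⁺ˡ (partitions⁺ k m n (bounded r l
            (p≤m ∷ All.map (λ le → ≤-trans le p≤m) (parts≤head (nonincreasing (isPartition r))))))
    ... | inj₂ refl = ∈-++⁺ʳ (partitions k m n) (withLargest⁺ k m n bp)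

    withLargest⁺ (suc k) m n
      (bounded (mkIsRegularPartition (mkIsPartition (_ ∷ pos) dec tot) (∤m ∷ reg)) (s≤s l) (_ ∷ b))
      with ℓ ∣? suc m | suc m ≤? n
    ... | yes ∣m | _      = ⊥-elim (∤m ∣m)
    ... | no _   | no m≰n = ⊥-elim (m≰n (≤-trans (m≤m+n (suc m) _) (≤-reflexive tot)))
    ... | no _   | yes _  = ∈-map⁺ (suc m ∷_) (partitions⁺ k (suc m) (n ∸ suc m)
            (bounded (mkIsRegularPartition
               (mkIsPartition pos (Linked.tail dec)
                 (trans (sym (m+n∸m≡n (suc m) _)) (cong (_∸ suc m) tot))) reg) l b))

    partitions-unique : ∀ k m n → Unique (partitions k m n)
    withLargest-unique : ∀ k m n → Unique (withLargest k m n)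

    partitions-unique k zero    zero    = [] ∷ []
    partitions-unique k zero    (suc n) = []
    partitions-unique k (suc m) n       =
      Unique.++⁺ (partitions-unique k m n) (withLargest-unique k m n)
        λ (p∈ , q∈) → absurd (partitions⁻ k m n p∈) (withLargest⁻ k m n q∈)
      where
      absurd : ∀ {ps} → BoundedPartition k m n ps →
               ¬ (∃ λ qs → ps ≡ suc m ∷ qs × BoundedPartition k (suc m) n ps)
      absurd (bounded _ _ (1+m≤m ∷ _)) (_ , refl , _) = 1+n≰n 1+m≤m

    withLargest-unique zero    m n = []
    withLargest-unique (suc k) m n with ℓ ∣? suc m | suc m ≤? n
    ... | no _  | yes _ = Unique.map⁺ (proj₂ ∘ List.∷-injective) (partitions-unique k (suc m) (n ∸ suc m))
    ... | yes _ | yes _ = []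
    ... | yes _ | no _  = []
    ... | no _  | no _  = []

    -- A partition of n has at most n parts, each at most n, so bounds that reach n exclude nothing
    -- and can be exchanged.
    odd-partitions-cong : ∀ {k k′ m m′ n} → n ≤ k → n ≤ k′ → (n ≤ m × n ≤ m′) ⊎ m ≡ m′ →
                          odd (partitions k m n) ≡ odd (partitions k′ m′ n)
    odd-partitions-cong {k} {k′} {m} {m′} {n} n≤k n≤k′ m~m′ =
      odd-sameElements (List.≡-dec _≟_) (partitions-unique k m n) (partitions-unique k′ m′ n)
        (λ p∈ → partitions⁺ k′ m′ n (convert n≤k′ m~m′ (partitions⁻ k m n p∈)))
        (λ p∈ → partitions⁺ k m n (convert n≤k (flip m~m′) (partitions⁻ k′ m′ n p∈)))
      where
      flip : ∀ {m m′} → (n ≤ m × n ≤ m′) ⊎ m ≡ m′ → (n ≤ m′ × n ≤ m) ⊎ m′ ≡ m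
      flip (inj₁ (p , q)) = inj₁ (q , p)
      flip (inj₂ eq)      = inj₂ (sym eq)
      convert : ∀ {k k′ m m′ ps} → n ≤ k′ → (n ≤ m × n ≤ m′) ⊎ m ≡ m′ →
                BoundedPartition k m n ps → BoundedPartition k′ m′ n ps
      convert {ps = ps} n≤k′ (inj₁ (_ , n≤m′)) (bounded p _ _) with total (isPartition p)
      ... | refl = bounded p (≤-trans (length≤sum (positive (isPartition p))) n≤k′)
                     (All.map (λ le → ≤-trans le n≤m′) (parts≤sum ps))
      convert {ps = ps} n≤k′ (inj₂ refl) (bounded p _ b) with total (isPartition p)
      ... | refl = bounded p (≤-trans (length≤sum (positive (isPartition p))) n≤k′) b

    -- The first n is the bound on the number of parts, which is no restriction for partitions of n.
    regularSeries : ℕ → Series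
    regularSeries m n = odd (partitions n m n)

    regularSeries-0 : ∀ n → regularSeries 0 n ≡ 𝟙 n
    regularSeries-0 zero    = refl
    regularSeries-0 (suc n) = refl

    regularSeries-∣ : ∀ m → ℓ ∣ suc m → ∀ n → regularSeries (suc m) n ≡ regularSeries m n
    regularSeries-∣ m ∣m zero    = trans (⨁-++ (partitions 0 m 0) [] _) (xor-identityʳ _)
    regularSeries-∣ m ∣m (suc n) with ℓ ∣? suc m | suc m ≤? suc n
    ... | yes _ | yes _ = trans (⨁-++ (partitions (suc n) m (suc n)) [] _) (xor-identityʳ _)
    ... | yes _ | no _  = trans (⨁-++ (partitions (suc n) m (suc n)) [] _) (xor-identityʳ _)
    ... | no ∤m | _     = ⊥-elim (∤m ∣m)

    -- Removing one copy of the largest part `suc m` leaves an arbitrary regular partition with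
    -- parts up to `suc m`.
    odd-withLargest : ∀ m → ℓ ∤ suc m → ∀ n → odd (withLargest n m n) ≡ (X (suc m) ⊠ regularSeries (suc m)) n
    odd-withLargest m ∤m zero = refl
    odd-withLargest m ∤m (suc n) with ℓ ∣? suc m | suc m ≤? suc n
    ... | yes ∣m | _      = ⊥-elim (∤m ∣m)
    ... | no _   | no m≰n = sym (X-⊠-< (suc m) (regularSeries (suc m)) (suc n) (≰⇒> m≰n))
    ... | no _   | yes m≤n = begin
      odd (map (suc m ∷_) (partitions n (suc m) (n ∸ m)))
        ≡⟨ ⨁-map (suc m ∷_) (partitions n (suc m) (n ∸ m)) _ ⟩
      odd (partitions n (suc m) (n ∸ m))
        -- The recursion allows n parts for the rest, whereas `regularSeries` allows n ∸ m; both
        -- suffice for partitions of n ∸ m.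
        ≡⟨ odd-partitions-cong {m = suc m} (m∸n≤m n m) ≤-refl (inj₂ refl) ⟩
      regularSeries (suc m) (n ∸ m)
        ≡⟨ X-⊠-≥ (suc m) (regularSeries (suc m)) (n ∸ m) ⟨
      (X (suc m) ⊠ regularSeries (suc m)) (suc m + (n ∸ m))
        ≡⟨ cong (X (suc m) ⊠ regularSeries (suc m)) (m+[n∸m]≡n m≤n) ⟩
      (X (suc m) ⊠ regularSeries (suc m)) (suc n) ∎
      where open ≡-Reasoning

    -- Splitting by the largest part gives R(m+1) = R(m) + q^(m+1) R(m+1). Stating it as a product
    -- avoids inverting 1 + q^(m+1).
    regularSeries-∤ : ∀ m → ℓ ∤ suc m → ∀ n → ((𝟙 ⊞ X (suc m)) ⊠ regularSeries (suc m)) n ≡ regularSeries m n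
    regularSeries-∤ m ∤m n = begin
      ((𝟙 ⊞ X (suc m)) ⊠ regularSeries (suc m)) n
        ≡⟨ ⊠-distribʳ (regularSeries (suc m)) 𝟙 (X (suc m)) n ⟩
      (𝟙 ⊠ regularSeries (suc m)) n xor (X (suc m) ⊠ regularSeries (suc m)) n
        ≡⟨ cong₂ _xor_ (⊠-identityˡ (regularSeries (suc m)) n) (sym (odd-withLargest m ∤m n)) ⟩
      regularSeries (suc m) n xor odd (withLargest n m n)
        ≡⟨ cong (_xor odd (withLargest n m n)) (⨁-++ (partitions n m n) (withLargest n m n) _) ⟩
      (regularSeries m n xor odd (withLargest n m n)) xor odd (withLargest n m n)
        ≡⟨ xor-assoc (regularSeries m n) _ _ ⟩
      regularSeries m n xor (odd (withLargest n m n) xor odd (withLargest n m n))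
        ≡⟨ cong (regularSeries m n xor_) (xor-same (odd (withLargest n m n))) ⟩
      regularSeries m n xor false
        ≡⟨ xor-identityʳ (regularSeries m n) ⟩
      regularSeries m n ∎
      where open ≡-Reasoning

    regularSeries-stable : ∀ {m n} → n ≤ m → regularSeries m n ≡ odd (regularPartitions ℓ n)
    regularSeries-stable {m} {n} n≤m =
      odd-sameElements (List.≡-dec _≟_) (partitions-unique n m n) (regularPartitions-unique ℓ n)
        (λ {ps} p∈ → Equivalence.from (∈-regularPartitions ℓ n ps) (partition (partitions⁻ n m n p∈)))
        (λ {ps} p∈ → partitions⁺ n m n (bound (Equivalence.to (∈-regularPartitions ℓ n ps) p∈)))
      where
      bound : ∀ {ps} → IsRegularPartition ℓ n ps → BoundedPartition n m n ps
      bound {ps} p with total (isPartition p)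
      ... | refl = bounded p (length≤sum (positive (isPartition p)))
                     (All.map (λ le → ≤-trans le n≤m) (parts≤sum ps))

-- Finite search ranges and elementary congruences.

module QuadraticForms where

  open import Data.Bool.Base using (false)
  open import Data.Empty using (⊥-elim)
  open import Data.Integer.Base as ℤ using (ℤ; +_; -[1+_]; ∣_∣; _+_; _*_; _-_; -_)
  import Data.Integer.DivMod as ℤ
  import Data.Integer.Divisibility.Signed as ℤ∣
  import Data.Integer.Properties as ℤ
  open import Data.Integer.Tactic.RingSolver using (solve-∀)
  open import Data.List.Base using (List; []; _∷_; cartesianProduct; filter)
  open import Data.List.Membership.Propositional using (_∈_)
  open import Data.List.Membership.Propositional.Properties
    using (∈-cartesianProduct⁺; ∈-cartesianProduct⁻; ∈-filter⁺; ∈-filter⁻)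
  open import Data.List.Relation.Unary.All as All using ([]; _∷_)
  open import Data.List.Relation.Unary.AllPairs using ([]; _∷_)
  open import Data.List.Relation.Unary.Any using (here; there)
  open import Data.List.Relation.Unary.Unique.Propositional using (Unique)
  import Data.List.Relation.Unary.Unique.Propositional.Properties as Unique
  open import Data.Nat.Base as ℕ using (ℕ; zero; suc; _≤_; z≤n; s≤s)
  import Data.Nat.Divisibility as ℕ∣
  open import Data.Nat.Primality using (prime?; euclidsLemma)
  import Data.Nat.Properties as ℕ
  open import Data.Product.Base using (∃; _×_; _,_; proj₂)
  open import Data.Sum.Base using (_⊎_; inj₁; inj₂)
  open import Relation.Binary.PropositionalEquality
  open import Relation.Nullary.Decidable using (Dec; from-yes; map′; ¬?; _×-dec_; _⊎-dec_)
  open import Relation.Nullary.Negation using (¬_)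
  open Parity
  open PentagonalNumbers
  open PowerSeries
  open ℤ∣ using (divides) renaming (_∣_ to _∣ℤ_)
  open ≡-Reasoning

  ∈-interval⁺ : ∀ {n k} → ∣ k ∣ ≤ n → k ∈ interval n
  ∈-interval⁺ {n}     {k} le with ℕ.m≤n⇒m<n∨m≡n le
  ∈-interval⁺ {suc n} {k}        le | inj₁ (s≤s lt) = there (there (∈-interval⁺ lt))
  ∈-interval⁺ {zero}  {+ .0}     le | inj₂ refl     = here refl
  ∈-interval⁺ {suc n} {+ .suc n} le | inj₂ refl     = here refl
  ∈-interval⁺ {suc n} { -[1+ .n ]} le | inj₂ refl   = there (here refl)

  ∈-interval⁻ : ∀ n {k} → k ∈ interval n → ∣ k ∣ ≤ n
  ∈-interval⁻ zero    (here refl)          = z≤n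
  ∈-interval⁻ (suc n) (here refl)          = ℕ.≤-refl
  ∈-interval⁻ (suc n) (there (here refl))  = ℕ.≤-refl
  ∈-interval⁻ (suc n) (there (there k∈))   = ℕ.m≤n⇒m≤1+n (∈-interval⁻ n k∈)

  interval-unique : ∀ n → Unique (interval n)
  interval-unique zero    = [] ∷ []
  interval-unique (suc n) =
    ((λ ()) ∷ All.tabulate (outside refl)) ∷ All.tabulate (outside refl) ∷ interval-unique n
    where
    outside : ∀ {j} → ∣ j ∣ ≡ suc n → ∀ {k} → k ∈ interval n → j ≢ k
    outside eq k∈ refl = ℕ.1+n≰n (subst (_≤ n) eq (∈-interval⁻ n k∈))

  -- Ensures that every solution of bounded weight lies in the finite intervals searched.
  ∣k∣≤pentagonal : ∀ k → ∣ k ∣ ≤ pentagonal k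
  ∣k∣≤pentagonal (+ zero)  = z≤n
  ∣k∣≤pentagonal (+ suc n) = ℕ.≤-trans (ℕ.m≤m*n (suc n) (suc n)) (ℕ.m≤m+n _ _)
  ∣k∣≤pentagonal -[1+ n ]  = ℕ.≤-trans (ℕ.m≤m*n (suc n) (suc n)) (ℕ.m≤m+n _ _)



  2*triangle : ∀ n → + 2 * + triangle n ≡ + n * (+ 1 + + n)
  2*triangle zero    = refl
  2*triangle (suc n) = begin
    + 2 * (+ 1 + + n + + triangle n)             ≡⟨ distrib (+ n) (+ triangle n) ⟩
    + 2 * (+ 1 + + n) + + 2 * + triangle n       ≡⟨ cong (λ x → + 2 * (+ 1 + + n) + x) (2*triangle n) ⟩
    + 2 * (+ 1 + + n) + + n * (+ 1 + + n)        ≡⟨ factor (+ n) ⟩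
    (+ 1 + + n) * (+ 1 + (+ 1 + + n))            ∎
    where
    distrib : ∀ n t → + 2 * (+ 1 + n + t) ≡ + 2 * (+ 1 + n) + + 2 * t
    distrib = solve-∀
    factor : ∀ n → + 2 * (+ 1 + n) + n * (+ 1 + n) ≡ (+ 1 + n) * (+ 1 + (+ 1 + n))
    factor = solve-∀

  2*pentagonal : ∀ k → + 2 * + pentagonal k ≡ k * (+ 3 * k + + 1)
  2*pentagonal (+ n) = begin
    + 2 * (+ (n ℕ.* n) + + triangle n)       ≡⟨ cong (λ x → + 2 * (x + + triangle n)) (ℤ.pos-* n n) ⟩
    + 2 * (+ n * + n + + triangle n)         ≡⟨ distrib (+ n) (+ triangle n) ⟩
    + 2 * (+ n * + n) + + 2 * + triangle n   ≡⟨ cong (λ x → + 2 * (+ n * + n) + x) (2*triangle n) ⟩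
    + 2 * (+ n * + n) + + n * (+ 1 + + n)    ≡⟨ factor (+ n) ⟩
    + n * (+ 3 * + n + + 1)                  ∎
    where
    distrib : ∀ n t → + 2 * (n * n + t) ≡ + 2 * (n * n) + + 2 * t
    distrib = solve-∀
    factor : ∀ n → + 2 * (n * n) + n * (+ 1 + n) ≡ n * (+ 3 * n + + 1)
    factor = solve-∀
  2*pentagonal -[1+ n ] = begin
    + 2 * (+ (suc n ℕ.* suc n) + + triangle n)    ≡⟨ cong (λ x → + 2 * (x + + triangle n)) (ℤ.pos-* (suc n) (suc n)) ⟩
    + 2 * (+ suc n * + suc n + + triangle n)      ≡⟨ distrib (+ suc n) (+ triangle n) ⟩
    + 2 * (+ suc n * + suc n) + + 2 * + triangle n  ≡⟨ cong (λ x → + 2 * (+ suc n * + suc n) + x) (2*triangle n) ⟩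
    + 2 * (+ suc n * + suc n) + + n * + suc n     ≡⟨ factor (+ n) ⟩
    - (+ 1 + + n) * (+ 3 * - (+ 1 + + n) + + 1)   ∎
    where
    distrib : ∀ n t → + 2 * (n * n + t) ≡ + 2 * (n * n) + + 2 * t
    distrib = solve-∀
    factor : ∀ n → + 2 * ((+ 1 + n) * (+ 1 + n)) + n * (+ 1 + n) ≡
             - (+ 1 + n) * (+ 3 * - (+ 1 + n) + + 1)
    factor = solve-∀

  square : ℤ → ℕ
  square m = ∣ m ∣ ℕ.* ∣ m ∣

  +square : ∀ m → + square m ≡ m * m
  +square (+ n)    = ℤ.pos-* n n
  +square -[1+ n ] = ℤ.pos-* (suc n) (suc n)

  ∣m∣≤square : ∀ m → ∣ m ∣ ≤ square m
  ∣m∣≤square m with ∣ m ∣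
  ... | zero  = z≤n
  ... | suc n = ℕ.m≤m*n (suc n) (suc n)

  multiple≢1 : ∀ d x → + suc (suc d) * x ≢ + 1
  multiple≢1 d x eq
    with ℕ∣.∣1⇒≡1 (ℤ∣.∣⇒∣ᵤ {+ suc (suc d)} {+ 1} (divides x (trans (sym eq) (ℤ.*-comm (+ suc (suc d)) x))))
  ... | ()

  -- m ≢ 2 (mod 3)
  Admissible : ℤ → Set
  Admissible m = ¬ (+ 3 ∣ℤ m + + 1)

  admissible? : ∀ m → Dec (Admissible m)
  admissible? m = ¬? (+ 3 ℤ∣.∣? m + + 1)

  admissibles : ℕ → List ℤ
  admissibles n = filter admissible? (interval n)

  admissible-3t : ∀ t → Admissible (+ 3 * t)
  admissible-3t t (divides q eq) = multiple≢1 1 (q - t) (begin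
    + 3 * (q - t)              ≡⟨ lemma q t ⟩
    q * + 3 - + 3 * t          ≡⟨ cong (_- + 3 * t) eq ⟨
    (+ 3 * t + + 1) - + 3 * t  ≡⟨ lemma′ t ⟩
    + 1                        ∎)
    where
    lemma : ∀ q t → + 3 * (q - t) ≡ q * + 3 - + 3 * t
    lemma = solve-∀
    lemma′ : ∀ t → (+ 3 * t + + 1) - + 3 * t ≡ + 1
    lemma′ = solve-∀

  admissible-3t+1 : ∀ t → Admissible (+ 3 * t + + 1)
  admissible-3t+1 t (divides q eq) = multiple≢1 1 (t - q + + 1) (begin
    + 3 * (t - q + + 1)                          ≡⟨ lemma q t ⟩
    + 3 * t + + 1 + + 1 + + 1 - q * + 3          ≡⟨ cong (λ x → x + + 1 - q * + 3) eq ⟩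
    q * + 3 + + 1 - q * + 3                      ≡⟨ lemma′ q ⟩
    + 1                                          ∎)
    where
    lemma : ∀ q t → + 3 * (t - q + + 1) ≡ + 3 * t + + 1 + + 1 + + 1 - q * + 3
    lemma = solve-∀
    lemma′ : ∀ q → q * + 3 + + 1 - q * + 3 ≡ + 1
    lemma′ = solve-∀

  admissible⇒ : ∀ m → Admissible m → ∃ λ t → m ≡ + 3 * t ⊎ m ≡ + 3 * t + + 1
  admissible⇒ m adm with m ℤ.%ℕ 3 | ℤ.n%ℕd<d m 3 | ℤ.a≡a%ℕn+[a/ℕn]*n m 3
  ... | 0 | _ | eq = m ℤ./ℕ 3 , inj₁ (trans eq (lemma (m ℤ./ℕ 3)))
    where lemma : ∀ q → + 0 + q * + 3 ≡ + 3 * q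
          lemma = solve-∀
  ... | 1 | _ | eq = m ℤ./ℕ 3 , inj₂ (trans eq (lemma (m ℤ./ℕ 3)))
    where lemma : ∀ q → + 1 + q * + 3 ≡ + 3 * q + + 1
          lemma = solve-∀
  ... | 2 | _ | eq = ⊥-elim (adm (divides (m ℤ./ℕ 3 + + 1) (trans (cong (_+ + 1) eq) (lemma (m ℤ./ℕ 3)))))
    where lemma : ∀ q → + 2 + q * + 3 + + 1 ≡ (q + + 1) * + 3
          lemma = solve-∀
  ... | suc (suc (suc _)) | s≤s (s≤s (s≤s ())) | _

  even⊎odd : ∀ k → ∃ λ u → k ≡ + 2 * u ⊎ k ≡ + 2 * u + + 1
  even⊎odd k with k ℤ.%ℕ 2 | ℤ.n%ℕd<d k 2 | ℤ.a≡a%ℕn+[a/ℕn]*n k 2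
  ... | 0 | _ | eq = k ℤ./ℕ 2 , inj₁ (trans eq (lemma (k ℤ./ℕ 2)))
    where lemma : ∀ q → + 0 + q * + 2 ≡ + 2 * q
          lemma = solve-∀
  ... | 1 | _ | eq = k ℤ./ℕ 2 , inj₂ (trans eq (lemma (k ℤ./ℕ 2)))
    where lemma : ∀ q → + 1 + q * + 2 ≡ + 2 * q + + 1
          lemma = solve-∀
  ... | suc (suc _) | s≤s (s≤s ()) | _

  -- Modulo 4 the inverse of 2u + 1 is 1 - 2u, because their product is 1 - 4u².
  odd-factor : ∀ a b u w → a ≡ + 2 * u + + 1 → a * b ≡ + 4 * w → b ≡ + 4 * ((+ 1 - + 2 * u) * w + u * u * b)
  odd-factor a b u w refl eq = begin
    b                                                    ≡⟨ lemma u b ⟩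
    (+ 1 - + 2 * u) * (a * b) + + 4 * (u * u * b)        ≡⟨ cong (λ x → (+ 1 - + 2 * u) * x + + 4 * (u * u * b)) eq ⟩
    (+ 1 - + 2 * u) * (+ 4 * w) + + 4 * (u * u * b)      ≡⟨ lemma′ u w b ⟩
    + 4 * ((+ 1 - + 2 * u) * w + u * u * b)              ∎
    where
    lemma : ∀ u b → b ≡ (+ 1 - + 2 * u) * ((+ 2 * u + + 1) * b) + + 4 * (u * u * b)
    lemma = solve-∀
    lemma′ : ∀ u w b → (+ 1 - + 2 * u) * (+ 4 * w) + + 4 * (u * u * b) ≡ + 4 * ((+ 1 - + 2 * u) * w + u * u * b)
    lemma′ = solve-∀

  -- One of a and b is odd, hence invertible modulo 4.
  4∣ab⇒4∣a⊎4∣b : ∀ a b w → a * b ≡ + 4 * w → ∀ v → a + b ≡ + 2 * v + + 1 →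
                 (∃ λ s → a ≡ + 4 * s) ⊎ (∃ λ s → b ≡ + 4 * s)
  4∣ab⇒4∣a⊎4∣b a b w ab v a+b with even⊎odd a
  ... | u , inj₂ eq = inj₂ (_ , odd-factor a b u w eq ab)
  ... | u , inj₁ refl = inj₁ (_ , odd-factor b a (v - u) w b-odd (trans (ℤ.*-comm b a) ab))
    where
    lemma : ∀ b u → b ≡ (+ 2 * u + b) - + 2 * u
    lemma = solve-∀
    lemma′ : ∀ u v → (+ 2 * v + + 1) - + 2 * u ≡ + 2 * (v - u) + + 1
    lemma′ = solve-∀
    b-odd : b ≡ + 2 * (v - u) + + 1
    b-odd = trans (lemma b u) (trans (cong (_- + 2 * u) a+b) (lemma′ u v))

  +double : ∀ n → + double n ≡ + 2 * + n
  +double zero    = refl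
  +double (suc n) = trans (cong (λ x → + 2 + x) (+double n)) (lemma (+ n))
    where
    lemma : ∀ n → + 2 + + 2 * n ≡ + 2 * (+ 1 + n)
    lemma = solve-∀

  double-injective : ∀ {m n} → double m ≡ double n → m ≡ n
  double-injective {zero}  {zero}  _  = refl
  double-injective {suc m} {suc n} eq = cong suc (double-injective (ℕ.suc-injective (ℕ.suc-injective eq)))

  n≤double : ∀ n → n ≤ double n
  n≤double zero    = z≤n
  n≤double (suc n) = s≤s (ℕ.m≤n⇒m≤1+n (n≤double n))

  +-cancelˡ-≡ : ∀ i j k → i + j ≡ i + k → j ≡ k
  +-cancelˡ-≡ i j k eq = begin
    j            ≡⟨ lemma i j ⟩
    i + j - i    ≡⟨ cong (_- i) eq ⟩
    i + k - i    ≡⟨ lemma i k ⟨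
    k            ∎
    where
    lemma : ∀ i j → j ≡ i + j - i
    lemma = solve-∀

  -- Eisenstein units: matching x² + 3y² with 4 (z² + 12m²).

  -- The exponents occurring in θ(q) θ(q³), in θ(q²) h and in θ(q) h, where h is the sum of q^(m²)
  -- over admissible m and θ(q²) is written as the sum of the squares of the terms of θ.
  weight₁₃ weight₂₂ weight₁₂ : ℤ × ℤ → ℕ
  weight₁₃ (k , l) = pentagonal k ℕ.+ 3 ℕ.* pentagonal l
  weight₂₂ (c , m) = (pentagonal c ℕ.+ pentagonal c) ℕ.+ square m
  weight₁₂ (c , m) = pentagonal c ℕ.+ square m

  2*weight₁₃ : ∀ k l → + 2 * + weight₁₃ (k , l) ≡ k * (+ 3 * k + + 1) + + 3 * (l * (+ 3 * l + + 1))
  2*weight₁₃ k l = begin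
    + 2 * (+ pentagonal k + + (3 ℕ.* pentagonal l))
      ≡⟨ cong (λ x → + 2 * (+ pentagonal k + x)) (ℤ.pos-* 3 (pentagonal l)) ⟩
    + 2 * (+ pentagonal k + + 3 * + pentagonal l)
      ≡⟨ lemma (+ pentagonal k) (+ pentagonal l) ⟩
    + 2 * + pentagonal k + + 3 * (+ 2 * + pentagonal l)
      ≡⟨ cong₂ (λ x y → x + + 3 * y) (2*pentagonal k) (2*pentagonal l) ⟩
    k * (+ 3 * k + + 1) + + 3 * (l * (+ 3 * l + + 1)) ∎
    where
    lemma : ∀ p q → + 2 * (p + + 3 * q) ≡ + 2 * p + + 3 * (+ 2 * q)
    lemma = solve-∀

  2*double-weight₂₂ : ∀ c m → + 2 * + double (weight₂₂ (c , m)) ≡ + 4 * (c * (+ 3 * c + + 1) + m * m)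
  2*double-weight₂₂ c m = begin
    + 2 * + double (weight₂₂ (c , m))
      ≡⟨ cong (λ x → + 2 * x) (+double (weight₂₂ (c , m))) ⟩
    + 2 * (+ 2 * (+ pentagonal c + + pentagonal c + + square m))
      ≡⟨ lemma (+ pentagonal c) (+ square m) ⟩
    + 4 * (+ 2 * + pentagonal c + + square m)
      ≡⟨ cong₂ (λ x y → + 4 * (x + y)) (2*pentagonal c) (+square m) ⟩
    + 4 * (c * (+ 3 * c + + 1) + m * m) ∎
    where
    lemma : ∀ p q → + 2 * (+ 2 * (p + p + q)) ≡ + 4 * (+ 2 * p + q)
    lemma = solve-∀

  -- With x = 6k + 1, y = 6l + 1 and z = 6c + 1, equality of the weights (the second one doubled) reads
  -- x² + 3y² = 4 (z² + 12m²), and the relation is x = z + 6m, y = ± (z - 2m): up to the sign of y,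
  -- (x + y √-3) / 2 is z - 2m √-3 times a unit of the Eisenstein integers.
  Rotation : ℤ × ℤ → ℤ × ℤ → Set
  Rotation (k , l) (c , m) = k ≡ c + m × (m ≡ + 3 * (c - l) ⊎ m ≡ + 3 * (c + l) + + 1)

  rotation? : ∀ x y → Dec (Rotation x y)
  rotation? (k , l) (c , m) = (k ℤ.≟ c + m) ×-dec ((m ℤ.≟ + 3 * (c - l)) ⊎-dec (m ℤ.≟ + 3 * (c + l) + + 1))

  rotation-weight : ∀ {x y} → Rotation x y → weight₁₃ x ≡ double (weight₂₂ y)
  rotation-weight {k , l} {c , m} (refl , r) = ℤ.+-injective (ℤ.*-cancelˡ-≡ (+ 2) _ _
    (trans (2*weight₁₃ (c + m) l) (trans (core r) (sym (2*double-weight₂₂ c m)))))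
    where
    core : m ≡ + 3 * (c - l) ⊎ m ≡ + 3 * (c + l) + + 1 →
           (c + m) * (+ 3 * (c + m) + + 1) + + 3 * (l * (+ 3 * l + + 1)) ≡
           + 4 * (c * (+ 3 * c + + 1) + m * m)
    core (inj₁ refl) = lemma c l
      where
      lemma : ∀ c l → (c + (+ 3 * (c - l))) * (+ 3 * (c + (+ 3 * (c - l))) + + 1) + + 3 * (l * (+ 3 * l + + 1)) ≡
              + 4 * (c * (+ 3 * c + + 1) + (+ 3 * (c - l)) * (+ 3 * (c - l)))
      lemma = solve-∀
    core (inj₂ refl) = lemma c l
      where
      lemma : ∀ c l → (c + (+ 3 * (c + l) + + 1)) * (+ 3 * (c + (+ 3 * (c + l) + + 1)) + + 1) + + 3 * (l * (+ 3 * l + + 1)) ≡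
              + 4 * (c * (+ 3 * c + + 1) + (+ 3 * (c + l) + + 1) * (+ 3 * (c + l) + + 1))
      lemma = solve-∀

  -- An even weight forces 4 to divide (l - k)(l + k - 1). The two factors have odd sum, so one of
  -- them carries the whole 4, and this decides the sign of y in the relation.
  rotation-total : ∀ k l j → weight₁₃ (k , l) ≡ double j →
                   ∃ λ c → ∃ λ m → Admissible m × Rotation (k , l) (c , m)
  rotation-total k l j eq =
    conclude (4∣ab⇒4∣a⊎4∣b (l - k) (l + k - + 1) (+ j - k * k - + 2 * (l * l) - l) product (l - + 1) (sum k l))
    where
    sum : ∀ k l → l - k + (l + k - + 1) ≡ + 2 * (l - + 1) + + 1
    sum = solve-∀
    expand : ∀ k l → (l - k) * (l + k - + 1) ≡
             k * (+ 3 * k + + 1) + + 3 * (l * (+ 3 * l + + 1)) - + 4 * (k * k + + 2 * (l * l) + l)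
    expand = solve-∀
    collect : ∀ j k l → + 2 * (+ 2 * j) - + 4 * (k * k + + 2 * (l * l) + l) ≡ + 4 * (j - k * k - + 2 * (l * l) - l)
    collect = solve-∀
    product : (l - k) * (l + k - + 1) ≡ + 4 * (+ j - k * k - + 2 * (l * l) - l)
    product = begin
      (l - k) * (l + k - + 1)
        ≡⟨ expand k l ⟩
      k * (+ 3 * k + + 1) + + 3 * (l * (+ 3 * l + + 1)) - r
        ≡⟨ cong (_- r) (2*weight₁₃ k l) ⟨
      + 2 * + weight₁₃ (k , l) - r
        ≡⟨ cong (λ x → + 2 * x - r) (trans (cong (λ x → + x) eq) (+double j)) ⟩
      + 2 * (+ 2 * + j) - r
        ≡⟨ collect (+ j) k l ⟩
      + 4 * (+ j - k * k - + 2 * (l * l) - l) ∎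
      where r = + 4 * (k * k + + 2 * (l * l) + l)
    case₁ : ∀ s → l - k ≡ + 4 * s → k ≡ l - s + + 3 * (l - s - l)
    case₁ s l-k = begin
      k                          ≡⟨ lemma k l ⟩
      l - (l - k)                ≡⟨ cong (λ x → l - x) l-k ⟩
      l - + 4 * s                ≡⟨ lemma′ l s ⟩
      l - s + + 3 * (l - s - l)  ∎
      where
      lemma : ∀ k l → k ≡ l - (l - k)
      lemma = solve-∀
      lemma′ : ∀ l s → l - + 4 * s ≡ l - s + + 3 * (l - s - l)
      lemma′ = solve-∀
    case₂ : ∀ s → l + k - + 1 ≡ + 4 * s → k ≡ s - l + (+ 3 * (s - l + l) + + 1)
    case₂ s l+k = begin
      k                                  ≡⟨ lemma k l ⟩
      (l + k - + 1) - l + + 1            ≡⟨ cong (λ x → x - l + + 1) l+k ⟩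
      + 4 * s - l + + 1                  ≡⟨ lemma′ l s ⟩
      s - l + (+ 3 * (s - l + l) + + 1)  ∎
      where
      lemma : ∀ k l → k ≡ (l + k - + 1) - l + + 1
      lemma = solve-∀
      lemma′ : ∀ l s → + 4 * s - l + + 1 ≡ s - l + (+ 3 * (s - l + l) + + 1)
      lemma′ = solve-∀
    conclude : (∃ λ s → l - k ≡ + 4 * s) ⊎ (∃ λ s → l + k - + 1 ≡ + 4 * s) →
               ∃ λ c → ∃ λ m → Admissible m × Rotation (k , l) (c , m)
    conclude (inj₁ (s , l-k)) =
      -- Here m = -3s and c = l - s, so that k = l - 4s is c + m. In the other case m = 3s + 1 and c
      -- = s - l.
      l - s , + 3 * (l - s - l) , admissible-3t (l - s - l) , case₁ s l-k , inj₁ refl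
    conclude (inj₂ (s , l+k)) =
      s - l , + 3 * (s - l + l) + + 1 , admissible-3t+1 (s - l + l) , case₂ s l+k , inj₂ refl

  rotation-surjective : ∀ c m → Admissible m → ∃ λ k → ∃ λ l → Rotation (k , l) (c , m)
  rotation-surjective c m adm with admissible⇒ m adm
  ... | t , inj₁ refl = _ , c - t , refl , inj₁ (lemma c t)
    where
    lemma : ∀ c t → + 3 * t ≡ + 3 * (c - (c - t))
    lemma = solve-∀
  ... | t , inj₂ refl = _ , t - c , refl , inj₂ (lemma c t)
    where
    lemma : ∀ c t → + 3 * t + + 1 ≡ + 3 * (c + (t - c)) + + 1
    lemma = solve-∀

  -- The two sides are 4c - 3l and 4c′ + 3l + 1, which have different parity.
  rotations-disjoint : ∀ c c′ l → c + + 3 * (c - l) ≢ c′ + (+ 3 * (c′ + l) + + 1)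
  rotations-disjoint c c′ l eq = multiple≢1 0 (+ 2 * c - + 2 * c′ - + 3 * l) (begin
    + 2 * (+ 2 * c - + 2 * c′ - + 3 * l)                             ≡⟨ lemma c c′ l ⟩
    c + + 3 * (c - l) - (c′ + + 3 * (c′ + l))                        ≡⟨ cong (_- (c′ + + 3 * (c′ + l))) eq ⟩
    c′ + (+ 3 * (c′ + l) + + 1) - (c′ + + 3 * (c′ + l))              ≡⟨ lemma′ c′ l ⟩
    + 1                                                              ∎)
    where
    lemma : ∀ c c′ l → + 2 * (+ 2 * c - + 2 * c′ - + 3 * l) ≡ c + + 3 * (c - l) - (c′ + + 3 * (c′ + l))
    lemma = solve-∀
    lemma′ : ∀ c l → c + (+ 3 * (c + l) + + 1) - (c + + 3 * (c + l)) ≡ + 1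
    lemma′ = solve-∀

  rotation-functional : ∀ {x y y′} → Rotation x y → Rotation x y′ → y ≡ y′
  rotation-functional {k , l} {c , _} {c′ , _} (refl , inj₁ refl) (eq , inj₁ refl) =
    cong (λ c → c , + 3 * (c - l)) (ℤ.*-cancelˡ-≡ (+ 4) c c′ (begin
      + 4 * c                          ≡⟨ lemma c l ⟩
      c + + 3 * (c - l) + + 3 * l      ≡⟨ cong (λ x → x + + 3 * l) eq ⟩
      c′ + + 3 * (c′ - l) + + 3 * l    ≡⟨ lemma c′ l ⟨
      + 4 * c′                         ∎))
    where
    lemma : ∀ c l → + 4 * c ≡ c + + 3 * (c - l) + + 3 * l
    lemma = solve-∀
  rotation-functional {k , l} {c , _} {c′ , _} (refl , inj₂ refl) (eq , inj₂ refl) =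
    cong (λ c → c , + 3 * (c + l) + + 1) (ℤ.*-cancelˡ-≡ (+ 4) c c′ (begin
      + 4 * c                                              ≡⟨ lemma c l ⟩
      c + (+ 3 * (c + l) + + 1) - + 3 * l - + 1            ≡⟨ cong (λ x → x - + 3 * l - + 1) eq ⟩
      c′ + (+ 3 * (c′ + l) + + 1) - + 3 * l - + 1          ≡⟨ lemma c′ l ⟨
      + 4 * c′                                             ∎))
    where
    lemma : ∀ c l → + 4 * c ≡ c + (+ 3 * (c + l) + + 1) - + 3 * l - + 1
    lemma = solve-∀
  rotation-functional {k , l} {c , _} {c′ , _} (refl , inj₁ refl) (eq , inj₂ refl) =
    ⊥-elim (rotations-disjoint c c′ l eq)
  rotation-functional {k , l} {c , _} {c′ , _} (refl , inj₂ refl) (eq , inj₁ refl) =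
    ⊥-elim (rotations-disjoint c′ c l (sym eq))

  3x≢3y+1 : ∀ x y → + 3 * x ≢ + 3 * y + + 1
  3x≢3y+1 x y eq = multiple≢1 1 (x - y) (begin
    + 3 * (x - y)            ≡⟨ lemma x y ⟩
    + 3 * x - + 3 * y        ≡⟨ cong (_- + 3 * y) eq ⟩
    + 3 * y + + 1 - + 3 * y  ≡⟨ lemma′ (+ 3 * y) ⟩
    + 1                      ∎)
    where
    lemma : ∀ x y → + 3 * (x - y) ≡ + 3 * x - + 3 * y
    lemma = solve-∀
    lemma′ : ∀ x → x + + 1 - x ≡ + 1
    lemma′ = solve-∀

  -- The class of m modulo 3 tells which alternative holds: 0 for the first, 1 for the second. For
  -- the same reason the class 2 is never reached.
  rotation-injective : ∀ {x x′ y} → Rotation x y → Rotation x′ y → x ≡ x′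
  rotation-injective {_ , l} {_ , l′} {c , m} (refl , inj₁ e) (refl , inj₁ e′) =
    cong (c + m ,_) (begin
      l              ≡⟨ lemma c l ⟩
      c - (c - l)    ≡⟨ cong (λ x → c - x) (ℤ.*-cancelˡ-≡ (+ 3) (c - l) (c - l′) (trans (sym e) e′)) ⟩
      c - (c - l′)   ≡⟨ lemma c l′ ⟨
      l′             ∎)
    where
    lemma : ∀ c l → l ≡ c - (c - l)
    lemma = solve-∀
  rotation-injective {_ , l} {_ , l′} {c , m} (refl , inj₂ e) (refl , inj₂ e′) =
    cong (c + m ,_) (+-cancelˡ-≡ c l l′ (ℤ.*-cancelˡ-≡ (+ 3) (c + l) (c + l′) (begin
      + 3 * (c + l)                ≡⟨ lemma (+ 3 * (c + l)) ⟩
      + 3 * (c + l) + + 1 - + 1    ≡⟨ cong (_- + 1) (trans (sym e) e′) ⟩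
      + 3 * (c + l′) + + 1 - + 1   ≡⟨ lemma (+ 3 * (c + l′)) ⟨
      + 3 * (c + l′)               ∎)))
    where
    lemma : ∀ x → x ≡ x + + 1 - + 1
    lemma = solve-∀
  rotation-injective {_ , l} {_ , l′} {c , m} (refl , inj₁ e) (refl , inj₂ e′) =
    ⊥-elim (3x≢3y+1 (c - l) (c + l′) (trans (sym e) e′))
  rotation-injective {_ , l} {_ , l′} {c , m} (refl , inj₂ e) (refl , inj₁ e′) =
    ⊥-elim (3x≢3y+1 (c - l′) (c + l) (trans (sym e′) e))

  solutions : (ℤ × ℤ → ℕ) → List ℤ → List ℤ → ℕ → List (ℤ × ℤ)
  solutions w xs ys n = filter (λ p → w p ℕ.≟ n) (cartesianProduct xs ys)

  solutions-unique : ∀ w {xs ys} n → Unique xs → Unique ys → Unique (solutions w xs ys n)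
  solutions-unique w n uxs uys = Unique.filter⁺ (λ p → w p ℕ.≟ n) (Unique.cartesianProduct⁺ uxs uys)

  ∈-solutions⁺ : ∀ w {xs ys} n {x y} → x ∈ xs → y ∈ ys → w (x , y) ≡ n → (x , y) ∈ solutions w xs ys n
  ∈-solutions⁺ w n x∈ y∈ = ∈-filter⁺ (λ p → w p ℕ.≟ n) (∈-cartesianProduct⁺ x∈ y∈)

  ∈-solutions⁻ : ∀ w {xs ys} n {x y} → (x , y) ∈ solutions w xs ys n → (x ∈ xs × y ∈ ys) × w (x , y) ≡ n
  ∈-solutions⁻ w {xs} {ys} n p∈ with ∈-filter⁻ (λ p → w p ℕ.≟ n) {xs = cartesianProduct xs ys} p∈
  ... | p∈′ , eq = ∈-cartesianProduct⁻ xs ys p∈′ , eq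

  admissibles-unique : ∀ n → Unique (admissibles n)
  admissibles-unique n = Unique.filter⁺ admissible? (interval-unique n)

  ∈-admissibles⁺ : ∀ {n m} → ∣ m ∣ ≤ n → Admissible m → m ∈ admissibles n
  ∈-admissibles⁺ le = ∈-filter⁺ admissible? (∈-interval⁺ le)

  ∈-admissibles⁻ : ∀ n {m} → m ∈ admissibles n → Admissible m
  ∈-admissibles⁻ n m∈ = proj₂ (∈-filter⁻ admissible? {xs = interval n} m∈)

  -- Each coordinate is at most the weight in absolute value, so the bounds on `M` and `N` keep all
  -- partners inside the lists.
  odd-rotation : ∀ {M N j} → double j ≤ M → double j ≤ N →
    odd (solutions weight₁₃ (interval M) (interval N) (double j)) ≡
    odd (solutions weight₂₂ (interval M) (admissibles N) j)
  odd-rotation {M} {N} {j} 2j≤M 2j≤N = odd-matching rotation?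
    (solutions-unique weight₁₃ (double j) (interval-unique M) (interval-unique N))
    (solutions-unique weight₂₂ j (interval-unique M) (admissibles-unique N))
    row column
    where
    ∈ˡ : ∀ {k l} → weight₁₃ (k , l) ≡ double j → (k , l) ∈ solutions weight₁₃ (interval M) (interval N) (double j)
    ∈ˡ {k} {l} eq = ∈-solutions⁺ weight₁₃ (double j)
      (∈-interval⁺ (ℕ.≤-trans (∣k∣≤pentagonal k) (ℕ.≤-trans (ℕ.m≤m+n (pentagonal k) _) (ℕ.≤-trans (ℕ.≤-reflexive eq) 2j≤M))))
      (∈-interval⁺ (ℕ.≤-trans (∣k∣≤pentagonal l) (ℕ.≤-trans (ℕ.m≤n*m (pentagonal l) 3)
        (ℕ.≤-trans (ℕ.m≤n+m _ (pentagonal k)) (ℕ.≤-trans (ℕ.≤-reflexive eq) 2j≤N)))))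
      eq
    ∈ʳ : ∀ {c m} → weight₂₂ (c , m) ≡ j → Admissible m → (c , m) ∈ solutions weight₂₂ (interval M) (admissibles N) j
    ∈ʳ {c} {m} eq adm = ∈-solutions⁺ weight₂₂ j
      (∈-interval⁺ (ℕ.≤-trans (∣k∣≤pentagonal c) (ℕ.≤-trans (ℕ.m≤m+n _ _) (ℕ.≤-trans (ℕ.m≤m+n _ _) (j≤ 2j≤M)))))
      (∈-admissibles⁺ (ℕ.≤-trans (∣m∣≤square m) (ℕ.≤-trans (ℕ.m≤n+m _ _) (j≤ 2j≤N))) adm)
      eq
      where
      j≤ : ∀ {B} → double j ≤ B → weight₂₂ (c , m) ≤ B
      j≤ le = ℕ.≤-trans (ℕ.≤-reflexive eq) (ℕ.≤-trans (n≤double j) le)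
    row : ∀ {x} → x ∈ solutions weight₁₃ (interval M) (interval N) (double j) →
          ExactlyOne (solutions weight₂₂ (interval M) (admissibles N) j) (Rotation x)
    row {k , l} x∈ with proj₂ (∈-solutions⁻ weight₁₃ {interval M} {interval N} (double j) x∈)
    ... | eq with rotation-total k l j eq
    ... | c , m , adm , r =
      (c , m) , ∈ʳ {c} {m} (double-injective (trans (sym (rotation-weight {k , l} {c , m} r)) eq)) adm , r ,
      λ {y} _ r′ → rotation-functional {k , l} {y} {c , m} r′ r
    column : ∀ {y} → y ∈ solutions weight₂₂ (interval M) (admissibles N) j →
             ExactlyOne (solutions weight₁₃ (interval M) (interval N) (double j)) (λ x → Rotation x y)
    column {c , m} y∈ with ∈-solutions⁻ weight₂₂ {interval M} {admissibles N} j y∈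
    ... | (_ , m∈) , eq with rotation-surjective c m (∈-admissibles⁻ N m∈)
    ... | k , l , r =
      (k , l) , ∈ˡ {k} {l} (trans (rotation-weight {k , l} {c , m} r) (cong double eq)) , r ,
      λ {x} _ r′ → rotation-injective {x} {k , l} {c , m} r′ r

  -- The form z² + 24m² and the involution attached to the prime 29.

  norm : ℤ → ℤ → ℤ
  norm z m = z * z + + 24 * (m * m)

  norm-weight₁₂ : ∀ c m → norm (+ 6 * c + + 1) m ≡ + 24 * + weight₁₂ (c , m) + + 1
  norm-weight₁₂ c m = begin
    norm (+ 6 * c + + 1) m
      ≡⟨ expand c (m * m) ⟩
    + 12 * (c * (+ 3 * c + + 1)) + + 24 * (m * m) + + 1
      ≡⟨ cong₂ (λ x y → + 12 * x + + 24 * y + + 1) (2*pentagonal c) (+square m) ⟨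
    + 12 * (+ 2 * + pentagonal c) + + 24 * + square m + + 1
      ≡⟨ collect (+ pentagonal c) (+ square m) ⟩
    + 24 * + weight₁₂ (c , m) + + 1 ∎
    where
    expand : ∀ c s → (+ 6 * c + + 1) * (+ 6 * c + + 1) + + 24 * s ≡ + 12 * (c * (+ 3 * c + + 1)) + + 24 * s + + 1
    expand = solve-∀
    collect : ∀ p s → + 12 * (+ 2 * p) + + 24 * s + + 1 ≡ + 24 * (p + s) + + 1
    collect = solve-∀

  -- (z′ + m′ √-24) = - (z + m √-24) (25 - 3 √-24) / 29, where 25² + 24 · 3² = 29².
  record Turn (z m z′ m′ : ℤ) : Set where
    constructor turn
    field
      29*z′ : + 29 * z′ ≡ - (+ 25 * z + + 72 * m)
      29*m′ : + 29 * m′ ≡ + 3 * z - + 25 * m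

  turn? : ∀ z m z′ m′ → Dec (Turn z m z′ m′)
  turn? z m z′ m′ = map′ (λ (ez , em) → turn ez em) (λ (turn ez em) → ez , em)
    ((+ 29 * z′ ℤ.≟ - (+ 25 * z + + 72 * m)) ×-dec (+ 29 * m′ ℤ.≟ + 3 * z - + 25 * m))

  turn-norm : ∀ z m z′ m′ → Turn z m z′ m′ → norm z m ≡ norm z′ m′
  turn-norm z m z′ m′ (turn ez em) = ℤ.*-cancelˡ-≡ (+ 841) _ _ (begin
    + 841 * norm z m                                         ≡⟨ multiplicative z m ⟩
    norm (- (+ 25 * z + + 72 * m)) (+ 3 * z - + 25 * m)      ≡⟨ cong₂ norm ez em ⟨
    norm (+ 29 * z′) (+ 29 * m′)                             ≡⟨ homogeneous z′ m′ ⟩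
    + 841 * norm z′ m′                                       ∎)
    where
    multiplicative : ∀ z m → + 841 * (z * z + + 24 * (m * m)) ≡
      - (+ 25 * z + + 72 * m) * - (+ 25 * z + + 72 * m) + + 24 * ((+ 3 * z - + 25 * m) * (+ 3 * z - + 25 * m))
    multiplicative = solve-∀
    homogeneous : ∀ z m → (+ 29 * z) * (+ 29 * z) + + 24 * ((+ 29 * m) * (+ 29 * m)) ≡
      + 841 * (z * z + + 24 * (m * m))
    homogeneous = solve-∀

  -- The multiplier has norm 1, so its conjugate is its inverse; negating both second coordinates
  -- turns multiplication by the conjugate into `Turn` again.
  turn-conjugate : ∀ z m z′ m′ → Turn z m z′ m′ → Turn z′ (- m′) z (- m)
  turn-conjugate z m z′ m′ (turn ez em) = turn
    (ℤ.*-cancelˡ-≡ (+ 29) _ _ (begin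
      + 29 * (+ 29 * z)                                                  ≡⟨ ring₁ z m ⟩
      - + 25 * - (+ 25 * z + + 72 * m) + + 72 * (+ 3 * z - + 25 * m)     ≡⟨ cong₂ (λ x y → - + 25 * x + + 72 * y) ez em ⟨
      - + 25 * (+ 29 * z′) + + 72 * (+ 29 * m′)                          ≡⟨ ring₂ z′ m′ ⟩
      + 29 * - (+ 25 * z′ + + 72 * - m′)                                 ∎))
    (ℤ.*-cancelˡ-≡ (+ 29) _ _ (begin
      + 29 * (+ 29 * - m)                                                ≡⟨ ring₃ z m ⟩
      + 3 * - (+ 25 * z + + 72 * m) + + 25 * (+ 3 * z - + 25 * m)        ≡⟨ cong₂ (λ x y → + 3 * x + + 25 * y) ez em ⟨
      + 3 * (+ 29 * z′) + + 25 * (+ 29 * m′)                             ≡⟨ ring₄ z′ m′ ⟩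
      + 29 * (+ 3 * z′ - + 25 * - m′)                                    ∎))
    where
    ring₁ : ∀ z m → + 29 * (+ 29 * z) ≡ - + 25 * - (+ 25 * z + + 72 * m) + + 72 * (+ 3 * z - + 25 * m)
    ring₁ = solve-∀
    ring₂ : ∀ z m → - + 25 * (+ 29 * z) + + 72 * (+ 29 * m) ≡ + 29 * - (+ 25 * z + + 72 * - m)
    ring₂ = solve-∀
    ring₃ : ∀ z m → + 29 * (+ 29 * - m) ≡ + 3 * - (+ 25 * z + + 72 * m) + + 25 * (+ 3 * z - + 25 * m)
    ring₃ = solve-∀
    ring₄ : ∀ z m → + 3 * (+ 29 * z) + + 25 * (+ 29 * m) ≡ + 29 * (+ 3 * z - + 25 * - m)
    ring₄ = solve-∀

  turn-fixed : ∀ z m → Turn z m z m → z ≡ + 0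
  turn-fixed z m (turn ez em) = ℤ.*-cancelˡ-≡ (+ 174) z (+ 0) (begin
    + 174 * z
      ≡⟨ ring₁ z m ⟩
    -- The fixed point equations read 54z + 72m = 0 and 3z - 54m = 0; three times the first plus
    -- four times the second eliminates m and leaves 174z = 0.
    + 3 * (+ 29 * z) - + 4 * (+ 29 * m) + (+ 87 * z + + 116 * m)
      ≡⟨ cong₂ (λ x y → + 3 * x - + 4 * y + (+ 87 * z + + 116 * m)) ez em ⟩
    + 3 * - (+ 25 * z + + 72 * m) - + 4 * (+ 3 * z - + 25 * m) + (+ 87 * z + + 116 * m)
      ≡⟨ ring₂ z m ⟩
    + 0 ∎)
    where
    ring₁ : ∀ z m → + 174 * z ≡ + 3 * (+ 29 * z) - + 4 * (+ 29 * m) + (+ 87 * z + + 116 * m)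
    ring₁ = solve-∀
    ring₂ : ∀ z m → + 3 * - (+ 25 * z + + 72 * m) - + 4 * (+ 3 * z - + 25 * m) + (+ 87 * z + + 116 * m) ≡ + 0
    ring₂ = solve-∀

  6c+1≢0 : ∀ c → + 6 * c + + 1 ≢ + 0
  6c+1≢0 c eq = multiple≢1 4 (- c) (begin
    + 6 * - c                    ≡⟨ lemma c ⟩
    + 1 - (+ 6 * c + + 1)        ≡⟨ cong (λ x → + 1 - x) eq ⟩
    + 1                          ∎)
    where
    lemma : ∀ c → + 6 * - c ≡ + 1 - (+ 6 * c + + 1)
    lemma = solve-∀

  6c+1-injective : ∀ c c′ → + 6 * c + + 1 ≡ + 6 * c′ + + 1 → c ≡ c′
  6c+1-injective c c′ eq = ℤ.*-cancelˡ-≡ (+ 6) c c′ (begin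
    + 6 * c                ≡⟨ lemma (+ 6 * c) ⟩
    + 6 * c + + 1 - + 1    ≡⟨ cong (_- + 1) eq ⟩
    + 6 * c′ + + 1 - + 1   ≡⟨ lemma (+ 6 * c′) ⟨
    + 6 * c′               ∎)
    where
    lemma : ∀ x → x ≡ x + + 1 - + 1
    lemma = solve-∀

  -- Integrality of the second coordinate already yields that of the first, together with its class
  -- 1 modulo 6.
  turn-total : ∀ c m w → + 3 * (+ 6 * c + + 1) - + 25 * m ≡ w * + 29 →
               ∃ λ c′ → Turn (+ 6 * c + + 1) m (+ 6 * c′ + + 1) w
  -- The multiple 192 of 3z - 25m makes both coefficients divisible by 29: 3 · 192 - 25 = 29 · 19
  -- and 25 · 192 + 72 = 29 · 168. Thus z′ = 19z - 168m - 192w, and as 6 divides 168 and 192 this is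
  -- 1 modulo 6.
  turn-total c m w eq = + 19 * c - + 28 * m - + 32 * w + + 3 , turn (begin
      + 29 * (+ 6 * (+ 19 * c - + 28 * m - + 32 * w + + 3) + + 1)
        ≡⟨ ring₁ c m w ⟩
      - (+ 25 * (+ 6 * c + + 1) + + 72 * m) + + 192 * ((+ 3 * (+ 6 * c + + 1) - + 25 * m) - w * + 29)
        ≡⟨ cong (λ x → - (+ 25 * (+ 6 * c + + 1) + + 72 * m) + + 192 * (x - w * + 29)) eq ⟩
      - (+ 25 * (+ 6 * c + + 1) + + 72 * m) + + 192 * (w * + 29 - w * + 29)
        ≡⟨ ring₂ (- (+ 25 * (+ 6 * c + + 1) + + 72 * m)) (w * + 29) ⟩
      - (+ 25 * (+ 6 * c + + 1) + + 72 * m) ∎)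
    (trans (ℤ.*-comm (+ 29) w) (sym eq))
    where
    ring₁ : ∀ c m w → + 29 * (+ 6 * (+ 19 * c - + 28 * m - + 32 * w + + 3) + + 1) ≡
            - (+ 25 * (+ 6 * c + + 1) + + 72 * m) + + 192 * ((+ 3 * (+ 6 * c + + 1) - + 25 * m) - w * + 29)
    ring₁ = solve-∀
    ring₂ : ∀ x y → x + + 192 * (y - y) ≡ x
    ring₂ = solve-∀

  turn-functional : ∀ z m {z₁ m₁ z₂ m₂} → Turn z m z₁ m₁ → Turn z m z₂ m₂ → z₁ ≡ z₂ × m₁ ≡ m₂
  turn-functional z m (turn ez₁ em₁) (turn ez₂ em₂) =
    ℤ.*-cancelˡ-≡ (+ 29) _ _ (trans ez₁ (sym ez₂)) , ℤ.*-cancelˡ-≡ (+ 29) _ _ (trans em₁ (sym em₂))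

  -- If both signs are integral, 29 divides 3z - 25m and 3z + 25m, hence their sum 6z and difference
  -- 50m, hence z and m.
  turns-disjoint : ∀ z m {z₁ m₁ z₂ m₂} → Turn z m z₁ m₁ → Turn z (- m) z₂ m₂ → + 841 ∣ℤ norm z m
  turns-disjoint z m {m₁ = m₁} {m₂ = m₂} (turn _ e₁) (turn _ e₂) = divides (norm x y) (begin
    norm z m                        ≡⟨ cong₂ norm 29∣z 29∣m ⟩
    norm (+ 29 * x) (+ 29 * y)      ≡⟨ homogeneous x y ⟩
    norm x y * + 841                ∎)
    where
    -- The quotients z/29 and m/29, from the inverses 5 · 6 = 29 + 1 and 11 · 50 = 19 · 29 - 1.
    x = + 5 * (m₁ + m₂) - z
    y = + 19 * m - + 11 * (m₂ - m₁)
    homogeneous : ∀ z m → (+ 29 * z) * (+ 29 * z) + + 24 * ((+ 29 * m) * (+ 29 * m)) ≡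
      (z * z + + 24 * (m * m)) * + 841
    homogeneous = solve-∀
    ring₁ : ∀ z m → z ≡ + 5 * ((+ 3 * z - + 25 * m) + (+ 3 * z - + 25 * - m)) - + 29 * z
    ring₁ = solve-∀
    ring₂ : ∀ z a b → + 5 * (+ 29 * a + + 29 * b) - + 29 * z ≡ + 29 * (+ 5 * (a + b) - z)
    ring₂ = solve-∀
    29∣z : z ≡ + 29 * x
    29∣z = trans (ring₁ z m) (trans (cong₂ (λ a b → + 5 * (a + b) - + 29 * z) (sym e₁) (sym e₂)) (ring₂ z m₁ m₂))
    ring₃ : ∀ z m → m ≡ + 551 * m - + 11 * ((+ 3 * z - + 25 * - m) - (+ 3 * z - + 25 * m))
    ring₃ = solve-∀
    ring₄ : ∀ m a b → + 551 * m - + 11 * (+ 29 * b - + 29 * a) ≡ + 29 * (+ 19 * m - + 11 * (b - a))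
    ring₄ = solve-∀
    29∣m : m ≡ + 29 * y
    29∣m = trans (ring₃ z m) (trans (cong₂ (λ a b → + 551 * m - + 11 * (b - a)) (sym e₁) (sym e₂)) (ring₄ m m₁ m₂))

  -- Modulo 3 the equation says m′ ≡ m, because 29 ≡ -25. Only this equation is assumed, with z
  -- arbitrary, so that the conjugate case can be obtained by replacing z with -z.
  turn-admissible : ∀ z m m′ → + 29 * m′ ≡ + 3 * z - + 25 * m → Admissible m → Admissible m′
  turn-admissible z m m′ eq adm (divides q eq′) = adm (divides (z - + 8 * m - + 29 * q + + 10) (begin
    m + + 1                                             ≡⟨ ring₁ z m ⟩
    + 3 * z - (+ 3 * z - + 25 * m) - + 24 * m + + 1     ≡⟨ cong (λ x → + 3 * z - x - + 24 * m + + 1) eq ⟨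
    + 3 * z - + 29 * m′ - + 24 * m + + 1                ≡⟨ ring₂ z m m′ ⟩
    + 3 * z - + 29 * (m′ + + 1) - + 24 * m + + 30       ≡⟨ cong (λ x → + 3 * z - + 29 * x - + 24 * m + + 30) eq′ ⟩
    + 3 * z - + 29 * (q * + 3) - + 24 * m + + 30        ≡⟨ ring₃ z m q ⟩
    (z - + 8 * m - + 29 * q + + 10) * + 3               ∎))
    where
    ring₁ : ∀ z m → m + + 1 ≡ + 3 * z - (+ 3 * z - + 25 * m) - + 24 * m + + 1
    ring₁ = solve-∀
    ring₂ : ∀ z m m′ → + 3 * z - + 29 * m′ - + 24 * m + + 1 ≡ + 3 * z - + 29 * (m′ + + 1) - + 24 * m + + 30
    ring₂ = solve-∀
    ring₃ : ∀ z m q → + 3 * z - + 29 * (q * + 3) - + 24 * m + + 30 ≡ (z - + 8 * m - + 29 * q + + 10) * + 3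
    ring₃ = solve-∀

  -- Multiplication by either of the two conjugate multipliers; the second is `Turn` transported by
  -- m ↦ -m.
  Reflection : ℤ × ℤ → ℤ × ℤ → Set
  Reflection (c , m) (c′ , m′) =
    Turn (+ 6 * c + + 1) m (+ 6 * c′ + + 1) m′ ⊎ Turn (+ 6 * c + + 1) (- m) (+ 6 * c′ + + 1) (- m′)

  reflection? : ∀ x y → Dec (Reflection x y)
  reflection? (c , m) (c′ , m′) = turn? _ _ _ _ ⊎-dec turn? _ _ _ _

  reflection-sym : ∀ {x y} → Reflection x y → Reflection y x
  reflection-sym {c , m} {c′ , m′} (inj₁ t) = inj₂ (turn-conjugate _ _ _ _ t)
  reflection-sym {c , m} {c′ , m′} (inj₂ t) =
    inj₁ (subst₂ (λ a b → Turn (+ 6 * c′ + + 1) a (+ 6 * c + + 1) b)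
      (ℤ.neg-involutive m′) (ℤ.neg-involutive m) (turn-conjugate _ _ _ _ t))

  reflection-irrefl : ∀ {x} → ¬ Reflection x x
  reflection-irrefl {c , m} (inj₁ t) = 6c+1≢0 c (turn-fixed _ _ t)
  reflection-irrefl {c , m} (inj₂ t) = 6c+1≢0 c (turn-fixed _ _ t)

  norm-neg : ∀ z m → norm z (- m) ≡ norm z m
  norm-neg = lemma
    where
    lemma : ∀ z m → z * z + + 24 * (- m * - m) ≡ z * z + + 24 * (m * m)
    lemma = solve-∀

  reflection-weight : ∀ {x y} → Reflection x y → weight₁₂ x ≡ weight₁₂ y
  reflection-weight {c , m} {c′ , m′} r = ℤ.+-injective (ℤ.*-cancelˡ-≡ (+ 24) _ _ (begin
    + 24 * + weight₁₂ (c , m)               ≡⟨ lemma (+ 24 * + weight₁₂ (c , m)) ⟩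
    + 24 * + weight₁₂ (c , m) + + 1 - + 1   ≡⟨ cong (_- + 1) (norm-weight₁₂ c m) ⟨
    norm (+ 6 * c + + 1) m - + 1            ≡⟨ cong (_- + 1) (core r) ⟩
    norm (+ 6 * c′ + + 1) m′ - + 1          ≡⟨ cong (_- + 1) (norm-weight₁₂ c′ m′) ⟩
    + 24 * + weight₁₂ (c′ , m′) + + 1 - + 1 ≡⟨ lemma (+ 24 * + weight₁₂ (c′ , m′)) ⟨
    + 24 * + weight₁₂ (c′ , m′)             ∎))
    where
    lemma : ∀ x → x ≡ x + + 1 - + 1
    lemma = solve-∀
    core : Reflection (c , m) (c′ , m′) → norm (+ 6 * c + + 1) m ≡ norm (+ 6 * c′ + + 1) m′
    core (inj₁ t) = turn-norm _ _ _ _ t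
    core (inj₂ t) = trans (sym (norm-neg (+ 6 * c + + 1) m))
                      (trans (turn-norm _ _ _ _ t) (norm-neg (+ 6 * c′ + + 1) m′))

  reflection-admissible : ∀ {c m c′ m′} → Reflection (c , m) (c′ , m′) → Admissible m → Admissible m′
  reflection-admissible {c} {m} {c′} {m′} (inj₁ (turn _ em)) = turn-admissible (+ 6 * c + + 1) m m′ em
  reflection-admissible {c} {m} {c′} {m′} (inj₂ (turn _ em)) =
    turn-admissible (- (+ 6 * c + + 1)) m m′ (begin
      + 29 * m′                                        ≡⟨ ring₁ m′ ⟩
      - (+ 29 * - m′)                                  ≡⟨ cong -_ em ⟩
      - (+ 3 * (+ 6 * c + + 1) - + 25 * - m)           ≡⟨ ring₂ (+ 6 * c + + 1) m ⟩
      + 3 * - (+ 6 * c + + 1) - + 25 * m               ∎)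
    where
    ring₁ : ∀ m → + 29 * m ≡ - (+ 29 * - m)
    ring₁ = solve-∀
    ring₂ : ∀ z m → - (+ 3 * z - + 25 * - m) ≡ + 3 * - z - + 25 * m
    ring₂ = solve-∀

  29∣ab⇒29∣a⊎29∣b : ∀ a b → + 29 ∣ℤ a * b → + 29 ∣ℤ a ⊎ + 29 ∣ℤ b
  29∣ab⇒29∣a⊎29∣b a b d
    with euclidsLemma ∣ a ∣ ∣ b ∣ (from-yes (prime? 29)) (subst (29 ℕ∣.∣_) (ℤ.abs-* a b) (ℤ∣.∣⇒∣ᵤ d))
  ... | inj₁ 29∣a = inj₁ (ℤ∣.∣ᵤ⇒∣ 29∣a)
  ... | inj₂ 29∣b = inj₂ (ℤ∣.∣ᵤ⇒∣ 29∣b)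

  -- Since 625 = 841 - 9 · 24, the product (3z - 25m)(3z + 25m) is 9 · `norm z m` - 841m². As 29 is
  -- prime, it divides one factor, and that factor selects the sign.
  reflection-total : ∀ c m → + 29 ∣ℤ norm (+ 6 * c + + 1) m → ∃ λ y → Reflection (c , m) y
  reflection-total c m (divides q eq) = conclude (29∣ab⇒29∣a⊎29∣b (+ 3 * z - + 25 * m) (+ 3 * z - + 25 * - m)
    (divides (+ 9 * q - + 29 * (m * m)) (begin
      (+ 3 * z - + 25 * m) * (+ 3 * z - + 25 * - m)    ≡⟨ ring₁ z m ⟩
      + 9 * norm z m - + 841 * (m * m)                 ≡⟨ cong (λ x → + 9 * x - + 841 * (m * m)) eq ⟩
      + 9 * (q * + 29) - + 841 * (m * m)               ≡⟨ ring₂ q (m * m) ⟩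
      (+ 9 * q - + 29 * (m * m)) * + 29                ∎)))
    where
    z = + 6 * c + + 1
    ring₁ : ∀ z m → (+ 3 * z - + 25 * m) * (+ 3 * z - + 25 * - m) ≡ + 9 * (z * z + + 24 * (m * m)) - + 841 * (m * m)
    ring₁ = solve-∀
    ring₂ : ∀ q s → + 9 * (q * + 29) - + 841 * s ≡ (+ 9 * q - + 29 * s) * + 29
    ring₂ = solve-∀
    conclude : + 29 ∣ℤ + 3 * z - + 25 * m ⊎ + 29 ∣ℤ + 3 * z - + 25 * - m → ∃ λ y → Reflection (c , m) y
    conclude (inj₁ (divides w e)) =
      let c′ , t = turn-total c m w e in (c′ , w) , inj₁ t
    conclude (inj₂ (divides w e)) =
      let c′ , t = turn-total c (- m) w e in
      (c′ , - w) , inj₂ (subst (Turn z (- m) (+ 6 * c′ + + 1)) (sym (ℤ.neg-involutive w)) t)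

  -- For a given sign the image is determined; two images with opposite signs would make the norm
  -- divisible by 841.
  reflection-functional : ∀ {c m y y′} → ¬ (+ 841 ∣ℤ norm (+ 6 * c + + 1) m) →
                          Reflection (c , m) y → Reflection (c , m) y′ → y ≡ y′
  reflection-functional {c} {m} {c₁ , m₁} {c₂ , m₂} _ (inj₁ t) (inj₁ t′)
    = let ez , em = turn-functional (+ 6 * c + + 1) m t t′ in
      cong₂ _,_ (6c+1-injective c₁ c₂ ez) em
  reflection-functional {c} {m} {c₁ , m₁} {c₂ , m₂} _ (inj₂ t) (inj₂ t′)
    = let ez , em = turn-functional (+ 6 * c + + 1) (- m) t t′ in
      cong₂ _,_ (6c+1-injective c₁ c₂ ez) (ℤ.neg-injective em)
  reflection-functional {c} {m} ∤ (inj₁ t) (inj₂ t′) = ⊥-elim (∤ (turns-disjoint (+ 6 * c + + 1) m t t′))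
  reflection-functional {c} {m} ∤ (inj₂ t) (inj₁ t′) = ⊥-elim (∤ (turns-disjoint (+ 6 * c + + 1) m t′ t))

  odd-solutions₁₂ : ∀ {M N n} → n ≤ M → n ≤ N → 29 ℕ∣.∣ 24 ℕ.* n ℕ.+ 1 → ¬ (841 ℕ∣.∣ 24 ℕ.* n ℕ.+ 1) →
                    odd (solutions weight₁₂ (interval M) (admissibles N) n) ≡ false
  odd-solutions₁₂ {M} {N} {n} n≤M n≤N 29∣ 841∤ = odd-involution reflection?
    (solutions-unique weight₁₂ n (interval-unique M) (admissibles-unique N))
    (λ {x} {y} → reflection-sym {x} {y}) (λ {x} → reflection-irrefl {x}) row
    where
    norm≡ : ∀ c m → weight₁₂ (c , m) ≡ n → norm (+ 6 * c + + 1) m ≡ + (24 ℕ.* n ℕ.+ 1)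
    norm≡ c m eq = trans (norm-weight₁₂ c m)
      (cong (_+ + 1) (trans (cong (λ x → + 24 * + x) eq) (sym (ℤ.pos-* 24 n))))
    ∈⁺ : ∀ {c m} → weight₁₂ (c , m) ≡ n → Admissible m → (c , m) ∈ solutions weight₁₂ (interval M) (admissibles N) n
    ∈⁺ {c} {m} eq adm = ∈-solutions⁺ weight₁₂ n
      (∈-interval⁺ (ℕ.≤-trans (∣k∣≤pentagonal c) (ℕ.≤-trans (ℕ.m≤m+n _ _) (ℕ.≤-trans (ℕ.≤-reflexive eq) n≤M))))
      (∈-admissibles⁺ (ℕ.≤-trans (∣m∣≤square m) (ℕ.≤-trans (ℕ.m≤n+m _ (pentagonal c)) (ℕ.≤-trans (ℕ.≤-reflexive eq) n≤N))) adm)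
      eq
    row : ∀ {x} → x ∈ solutions weight₁₂ (interval M) (admissibles N) n →
          ExactlyOne (solutions weight₁₂ (interval M) (admissibles N) n) (Reflection x)
    row {c , m} x∈ =
      let (_ , m∈) , eq = ∈-solutions⁻ weight₁₂ {interval M} {admissibles N} n x∈
          (c′ , m′) , r = reflection-total c m (ℤ∣.∣ᵤ⇒∣ (subst (λ x → 29 ℕ∣.∣ ∣ x ∣) (sym (norm≡ c m eq)) 29∣))
          841∤norm = λ d → 841∤ (subst (λ x → 841 ℕ∣.∣ ∣ x ∣) (norm≡ c m eq) (ℤ∣.∣⇒∣ᵤ d))
      in (c′ , m′) ,
         ∈⁺ {c′} {m′} (trans (sym (reflection-weight {c , m} {c′ , m′} r)) eq)
            (reflection-admissible {c} {m} {c′} {m′} r (∈-admissibles⁻ N m∈)) ,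
         r ,
         λ {y} _ r′ → reflection-functional {c} {m} {y} {c′ , m′} 841∤norm r′ r

-- The generating function identities modulo 2 and the even coefficients.

module EvenCoefficients where

  open import Defs
  open import Algebra.Bundles using (CommutativeRing)
  open import Data.Bool.Base using (true; false; _xor_)
  open import Data.Bool.Properties using (xor-same)
  open import Data.Integer.Base using (ℤ)
  open import Data.List.Base using (List; []; _∷_; cartesianProduct; length)
  open import Data.Nat.Base
  open import Data.Nat.Divisibility using (_∣_; divides; ∣m∣n⇒∣m+n; ∣m+n∣m⇒∣n)
  open import Data.Nat.Properties
  open import Data.Product.Base using (_×_; _,_)
  open import Function.Base using (_∘_)
  open import Relation.Binary.PropositionalEquality as ≡ using (_≡_; module ≡-Reasoning)
  open import Relation.Nullary.Negation using (¬_)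
  open Parity
  open PentagonalNumbers
  open PowerSeries
  open QuadraticForms
  open RegularPartitions

  b₃ : Series
  b₃ n = odd (regularPartitions 3 n)

  module Modulo (N : ℕ) where
    open CommutativeRing (truncated N)
      using (_≈_; setoid; *-congˡ; *-congʳ; *-cong; commutativeSemiring)
      renaming (refl to ≈-refl; trans to ≈-trans)
    open Sum (truncated N)
    open Characteristic2 (λ f n _ → xor-same (f n))

    module E₁ = Pentagonal X (λ n _ → X-0 n) (λ a b n _ → X-+ a b n)
    module E₃ = Pentagonal (λ e → X (e * 3)) (λ n _ → X-0 n)
      (λ a b n _ → ≡.trans (≡.cong (λ e → X e n) (*-distribʳ-+ 3 a b)) (X-+ (a * 3) (b * 3) n))

    -- A finite form of f_1 B = f_3, three factors at a time: those at 3m + 1 and 3m + 2 are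
    -- absorbed by the series of partitions, and the one at 3m + 3, where no new part is allowed,
    -- remains as a factor of the product in q³.
    euler-b₃ : ∀ m → E₁.euler 0 (m * 3) ⊠ regularSeries 3 (m * 3) ≈ E₃.euler 0 m
    euler-b₃ zero    = λ n _ → ≡.trans (⊠-identityˡ _ n) (regularSeries-0 3 n)
    euler-b₃ (suc m) = begin
      E₁.euler 0 (3 + d) ⊠ c (3 + d)
        ≈⟨ *-cong (≈-trans (E₁.euler-sucʳ 0 (2 + d)) (*-congʳ (≈-trans (E₁.euler-sucʳ 0 (1 + d))
             (*-congʳ (E₁.euler-sucʳ 0 d))))) (λ n _ → regularSeries-∣ 3 (2 + d) (divides (suc m) ≡.refl) n) ⟩
      (e ⊠ f 1 ⊠ f 2 ⊠ f 3) ⊠ c (2 + d)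
        ≈⟨ solve 5 (λ e x y z r → (e :* x :* y :* z) :* r := e :* (x :* (y :* r)) :* z) ≈-refl
             e (f 1) (f 2) (f 3) (c (2 + d)) ⟩
      e ⊠ (f 1 ⊠ (f 2 ⊠ c (2 + d))) ⊠ f 3
        ≈⟨ *-congʳ (*-congˡ (≈-trans (*-congˡ (λ n _ → regularSeries-∤ 3 (1 + d) (3∤ 1 (s≤s z≤n)) n))
                                     (λ n _ → regularSeries-∤ 3 d (3∤ 0 z≤n) n))) ⟩
      e ⊠ c d ⊠ f 3
        ≈⟨ *-congʳ (euler-b₃ m) ⟩
      E₃.euler 0 m ⊠ f 3
        ≈⟨ E₃.euler-sucʳ 0 m ⟨
      E₃.euler 0 (suc m) ∎
      where
      open import Relation.Binary.Reasoning.Setoid setoid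
      open import Algebra.Solver.Ring.NaturalCoefficients.Default commutativeSemiring
      d = m * 3
      c = regularSeries 3
      e = E₁.euler 0 d
      f : ℕ → Series
      f i = 𝟙 ⊞ X (i + d)
      3∤ : ∀ i → i ≤ 1 → ¬ (3 ∣ suc i + m * 3)
      3∤ i i≤1 3∣ with ∣m+n∣m⇒∣n (≡.subst (3 ∣_) (+-comm (suc i) (m * 3)) 3∣) (divides m ≡.refl)
      3∤ .0 z≤n       _ | divides (suc _) ()
      3∤ .1 (s≤s z≤n) _ | divides (suc _) ()

    -- The product in q takes three factors for each factor of the product in q³.
    M : ℕ
    M = N * 3

    θ θ₃ h : Series
    θ  = ∑ (interval M) (X ∘ pentagonal)
    θ₃ = ∑ (interval N) (λ k → X (pentagonal k * 3))
    h  = ∑ (admissibles N) (X ∘ square)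

    N≤M : N ≤ M
    N≤M = m≤m*n N 3

    X≈0 : ∀ e → N < e → X e ≈ 𝟘
    X≈0 e N<e n n≤N = vanish e n (≤-<-trans n≤N N<e)
      where
      vanish : ∀ e n → n < e → X e n ≡ false
      vanish (suc e) zero    _         = ≡.refl
      vanish (suc e) (suc n) (s≤s n<e) = vanish e n n<e

    θ⊠b₃ : θ ⊠ b₃ ≈ θ₃
    θ⊠b₃ = begin
      θ ⊠ b₃                                    ≈⟨ *-cong (E₁.euler≈∑ M (λ e M<e → X≈0 e (≤-<-trans N≤M M<e)))
                                                     (λ n n≤N → regularSeries-stable 3 (≤-trans n≤N N≤M)) ⟨
      E₁.euler 0 (N * 3) ⊠ regularSeries 3 (N * 3)    ≈⟨ euler-b₃ N ⟩
      E₃.euler 0 N                              ≈⟨ E₃.euler≈∑ N (λ e N<e → X≈0 (e * 3) (<-≤-trans N<e (m≤m*n e 3))) ⟩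
      θ₃                                        ∎
      where open import Relation.Binary.Reasoning.Setoid setoid

    ∑X-coefficient : ∀ {A : Set} (w : A → ℕ) xs n → ∑ xs (X ∘ w) n ≡ ⨁ xs (λ x → w x ≡ᵇ n)
    ∑X-coefficient w []       n = ≡.refl
    ∑X-coefficient w (x ∷ xs) n = ≡.cong (X (w x) n xor_) (∑X-coefficient w xs n)

    ∑X⊠∑X : ∀ (f g : ℤ → ℕ) xs ys n → n ≤ N →
            (∑ xs (X ∘ f) ⊠ ∑ ys (X ∘ g)) n ≡ odd (solutions (λ (a , b) → f a + g b) xs ys n)
    ∑X⊠∑X f g xs ys n n≤N = begin
      (∑ xs (X ∘ f) ⊠ ∑ ys (X ∘ g)) n
        ≡⟨ ∑-⊗-∑ xs ys (X ∘ f) (X ∘ g) n n≤N ⟩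
      ∑ (cartesianProduct xs ys) (λ (a , b) → X (f a) ⊠ X (g b)) n
        ≡⟨ ∑-cong (cartesianProduct xs ys) (λ (a , b) n _ → X-+ (f a) (g b) n) n n≤N ⟨
      ∑ (cartesianProduct xs ys) (X ∘ w) n
        ≡⟨ ∑X-coefficient w (cartesianProduct xs ys) n ⟩
      ⨁ (cartesianProduct xs ys) (λ p → w p ≡ᵇ n)
        ≡⟨ ⨁-filter (λ p → w p ≟ n) (cartesianProduct xs ys) ⟩
      odd (solutions w xs ys n) ∎
      where
      open ≡-Reasoning
      w : ℤ × ℤ → ℕ
      w (a , b) = f a + g b

    θ-0 : θ 0 ≡ true
    θ-0 = constant M
      where
      constant : ∀ m → ∑ (interval m) (X ∘ pentagonal) 0 ≡ true
      constant zero    = ≡.refl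
      constant (suc m) = constant m

    θ⊠even-b₃ : ∀ {j} → double j ≤ N → (θ ⊠ (b₃ ∘ double)) j ≡ (θ ⊠ (θ ⊠ h)) j
    θ⊠even-b₃ {j} 2j≤N = begin
      (θ ⊠ (b₃ ∘ double)) j                   ≡⟨ even-frobenius θ b₃ j ⟨
      (θ ⊠ (θ ⊠ b₃)) (double j)               ≡⟨ *-congˡ {x = θ} θ⊠b₃ (double j) 2j≤N ⟩
      (θ ⊠ θ₃) (double j)
        ≡⟨ *-congˡ {x = θ} (∑-cong (interval N) (λ k n _ → ≡.cong (λ e → X e n) (*-comm (pentagonal k) 3))) (double j) 2j≤N ⟩
      (θ ⊠ ∑ (interval N) (λ k → X (3 * pentagonal k))) (double j)
        ≡⟨ ∑X⊠∑X pentagonal (λ k → 3 * pentagonal k) (interval M) (interval N) (double j) 2j≤N ⟩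
      odd (solutions weight₁₃ (interval M) (interval N) (double j))
        ≡⟨ odd-rotation (≤-trans 2j≤N N≤M) 2j≤N ⟩
      odd (solutions weight₂₂ (interval M) (admissibles N) j)
        ≡⟨ ∑X⊠∑X (λ k → pentagonal k + pentagonal k) square (interval M) (admissibles N) j j≤N ⟨
      (∑ (interval M) (λ k → X (pentagonal k + pentagonal k)) ⊠ h) j
        -- In characteristic 2 the cross terms of θ² vanish, so doubling each exponent of θ gives θ
        -- ⊠ θ.
        ≡⟨ *-congʳ {x = h} (≈-trans (∑-square (interval M) (X ∘ pentagonal))
             (∑-cong (interval M) (λ k n _ → ≡.sym (X-+ (pentagonal k) (pentagonal k) n)))) j j≤N ⟨
      ((θ ⊠ θ) ⊠ h) j                         ≡⟨ ⊠-assoc θ θ h j ⟩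
      (θ ⊠ (θ ⊠ h)) j                         ∎
      where
      open ≡-Reasoning
      j≤N = ≤-trans (n≤double j) 2j≤N

  -- Working up to degree 2n provides the identities for all even coefficients up to that degree,
  -- which is what cancelling θ, of constant term 1, at coefficient n consumes.
  even-b₃ : ∀ n → 29 ∣ 24 * n + 1 → ¬ (841 ∣ 24 * n + 1) → b₃ (double n) ≡ false
  even-b₃ n 29∣ 841∤ = begin
    b₃ (double n)
      ≡⟨ ⊠-cancelˡ n θ (b₃ ∘ double) (θ ⊠ h) θ-0 (λ i≤n → θ⊠even-b₃ (double-mono i≤n)) ⟩
    (θ ⊠ h) n
      ≡⟨ ∑X⊠∑X pentagonal square (interval M) (admissibles (double n)) n (n≤double n) ⟩
    odd (solutions weight₁₂ (interval M) (admissibles (double n)) n)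
      ≡⟨ odd-solutions₁₂ (≤-trans (n≤double n) N≤M) (n≤double n) 29∣ 841∤ ⟩
    false ∎
    where
    open Modulo (double n)
    open ≡-Reasoning
    double-mono : ∀ {m n} → m ≤ n → double m ≤ double n
    double-mono z≤n       = z≤n
    double-mono (s≤s m≤n) = s≤s (s≤s (double-mono m≤n))

  odd≡false⇒2∣length : ∀ {A : Set} (xs : List A) → odd xs ≡ false → 2 ∣ length xs
  odd≡false⇒2∣length []           eq = divides 0 ≡.refl
  odd≡false⇒2∣length (_ ∷ [])     ()
  odd≡false⇒2∣length (_ ∷ _ ∷ xs) eq with odd xs | odd≡false⇒2∣length xs
  ... | false | 2∣ = ∣m∣n⇒∣m+n (divides 1 ≡.refl) (2∣ ≡.refl)

  double≡2* : ∀ n → double n ≡ 2 * n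
  double≡2* zero    = ≡.refl
  double≡2* (suc n) = ≡.cong suc (≡.trans (≡.cong suc (double≡2* n)) (≡.sym (+-suc n (n + 0))))

-- The residues modulo 29² and the congruence.

open import Defs
open import Data.Bool.Base using (false)
open import Data.List.Base using (List; []; _∷_)
open import Data.List.Membership.Propositional using (_∈_)
open import Data.List.Relation.Unary.All as All using (All)
open import Data.Nat.Base using (ℕ; _+_; _*_; _^_)
open import Data.Nat.DivMod using (_%_)
open import Data.Nat.Divisibility using (_∣_; _∣?_; divides; ∣m∣n⇒∣m+n; ∣m+n∣m⇒∣n; n∣m⇒m%n≡0; m∣m*n; ∣m⇒∣m*n)
import Data.Nat.Tactic.RingSolver as ℕ-Solver
open import Data.Product.Base using (_×_; proj₁; proj₂)
open import Relation.Binary.PropositionalEquality using (_≡_; sym; subst)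
open import Relation.Nullary.Decidable using (from-yes; ¬?; _×-dec_)
open import Relation.Nullary.Negation using (¬_)
open EvenCoefficients

residues : List ℕ
residues = 6 ∷ 64 ∷ 93 ∷ 122 ∷ 151 ∷ 180 ∷ 209 ∷ 238 ∷ 267 ∷ 296 ∷ 325 ∷ 354 ∷ 383 ∷ 412 ∷
         441 ∷ 470 ∷ 499 ∷ 528 ∷ 557 ∷ 586 ∷ 615 ∷ 644 ∷ 673 ∷ 702 ∷ 731 ∷ 760 ∷ 789 ∷ 818 ∷ []

-- Since 24 · 6 + 1 = 5 · 29, the first condition means α ≡ 6 (mod 29). Of the 29 such values below
-- 841 the list omits only 35, for which 24 · 35 + 1 = 841. The proof evaluates the decision
-- procedure.
residues-exact : All (λ α → 29 ∣ 24 * α + 1 × ¬ (841 ∣ 24 * α + 1)) residues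
residues-exact = from-yes (All.all? (λ α → (29 ∣? 24 * α + 1) ×-dec ¬? (841 ∣? 24 * α + 1)) residues)

theorem1p3 : (α : ℕ) →
    α ∈ (6 ∷ 64 ∷ 93 ∷ 122 ∷ 151 ∷ 180 ∷ 209 ∷ 238 ∷ 267 ∷ 296 ∷ 325 ∷ 354 ∷ 383 ∷ 412 ∷
    441 ∷ 470 ∷ 499 ∷ 528 ∷ 557 ∷ 586 ∷ 615 ∷ 644 ∷ 673 ∷ 702 ∷ 731 ∷ 760 ∷ 789 ∷ 818 ∷ []) →
    (n : ℕ) → b 3 (2 * (29 ^ 2 * n + α)) % 2 ≡ 0
theorem1p3 α α∈ n = n∣m⇒m%n≡0 _ 2 (odd≡false⇒2∣length (regularPartitions 3 (2 * k))
  (subst (λ i → b₃ i ≡ false) (double≡2* k) (even-b₃ k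
    (subst (29 ∣_) (sym shift) (∣m∣n⇒∣m+n (∣m⇒∣m*n (24 * n) (divides 29 _≡_.refl)) 29∣))
    (λ 841∣ → 841∤ (∣m+n∣m⇒∣n (subst (841 ∣_) shift 841∣) (m∣m*n (24 * n)))))))
  where
  k = 29 ^ 2 * n + α
  29∣  = proj₁ (All.lookup residues-exact α∈)
  841∤ = proj₂ (All.lookup residues-exact α∈)
  shift : 24 * (29 ^ 2 * n + α) + 1 ≡ 841 * (24 * n) + (24 * α + 1)
  shift = lemma n α
    where
    lemma : ∀ n α → 24 * (841 * n + α) + 1 ≡ 841 * (24 * n) + (24 * α + 1)
    lemma = ℕ-Solver.solve-∀
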